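{- For every integer $d\ge 2$ there exists an integer $n_1=n_1(d)$ such that every $d$-regular graph $G$ on $n\ge n_1$ vertices satisfies $\operatorname{tvs}(G)=\lceil (n+d)/(d+1)\rceil$.
   Context: All graphs are finite and simple, and need not be connected. For a positive integer $k$, a total $k$-labeling of a graph $G$ is a mapping $\lambda:V(G)\cup E(G)\to\{1,\ldots,k\}$. The weight of a vertex $v$ under $\lambda$ is $\operatorname{wt}_\lambda(v)=\lambda(v)+\sum_{e\ni v}\lambda(e)$, the sum being over the edges $e$ of $G$ incident with $v$. The labeling $\lambda$ is vertex irregular if $\operatorname{wt}_\lambda(u)\ne\operatorname{wt}_\lambda(v)$ for any two distinct vertices $u,v\in V(G)$. The total vertex irregularity strength $\operatorname{tvs}(G)$ is the smallest positive integer $k$ for which $G$ has a vertex irregular total $k$-labeling. -}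

module Defs where

open import Data.Bool using (Bool; false; T)
open import Data.Bool.Properties using (T?)
open import Data.Fin using (Fin; _<_)
open import Data.Fin.Properties using (_≟_; _<?_)
open import Data.List using (List; allFin; cartesianProduct; filter; length; map; mapMaybe)
open import Data.Maybe as Maybe using (Maybe)
open import Data.Nat as ℕ using (ℕ; NonZero; pred; _+_; _/_)
open import Data.Nat.ListAction using (sum)
open import Data.Product using (Σ-syntax; _×_; _,_)
open import Data.Sum using (_⊎_; inj₁; inj₂)
open import Relation.Binary.PropositionalEquality using (_≡_; _≢_)
open import Relation.Nullary using (Dec)
open import Relation.Nullary.Decidable using (_×-dec_; _⊎-dec_; dec⇒maybe)

record Graph (n : ℕ) : Set where
  field
    adj         : Fin n → Fin n → Bool
    symmetric   : ∀ u v → adj u v ≡ adj v u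
    irreflexive : ∀ v → adj v v ≡ false

open Graph public

Vertex : ∀ {n} → Graph n → Set
Vertex {n} G = Fin n

-- The unordered edge {u , v} is represented by its increasing ordered pair;
-- both proof components are propositions, so each edge occurs exactly once.
Edge : ∀ {n} → Graph n → Set
Edge {n} G = Σ[ (u , v) ∈ Fin n × Fin n ] (u < v × T (adj G u v))

Incident : ∀ {n} (G : Graph n) → Vertex G → Edge G → Set
Incident G x ((u , v) , _) = x ≡ u ⊎ x ≡ v

incident? : ∀ {n} (G : Graph n) (x : Vertex G) (e : Edge G) → Dec (Incident G x e)
incident? G x ((u , v) , _) = (x ≟ u) ⊎-dec (x ≟ v)

-- Lists every element of Edge G exactly once.
edges : ∀ {n} (G : Graph n) → List (Edge G)
edges {n} G = mapMaybe edge (cartesianProduct (allFin n) (allFin n))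
  where
  edge : Fin n × Fin n → Maybe (Edge G)
  edge (u , v) =
    Maybe.map ((u , v) ,_) (dec⇒maybe ((u <? v) ×-dec T? (adj G u v)))

incidentEdges : ∀ {n} (G : Graph n) → Vertex G → List (Edge G)
incidentEdges G v = filter (incident? G v) (edges G)

degree : ∀ {n} (G : Graph n) → Vertex G → ℕ
degree G v = length (incidentEdges G v)

Regular : ∀ {n} → ℕ → Graph n → Set
Regular d G = ∀ v → degree G v ≡ d

record TotalLabeling {n} (G : Graph n) (k : ℕ) : Set where
  field
    label     : Vertex G ⊎ Edge G → ℕ
    label-pos : ∀ x → 1 ℕ.≤ label x
    label-≤   : ∀ x → label x ℕ.≤ k

open TotalLabeling public

weight : ∀ {n} {G : Graph n} {k} → TotalLabeling G k → Vertex G → ℕ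
weight {G = G} ℓ v =
  label ℓ (inj₁ v) + sum (map (λ e → label ℓ (inj₂ e)) (incidentEdges G v))

VertexIrregular : ∀ {n} {G : Graph n} {k} → TotalLabeling G k → Set
VertexIrregular {G = G} ℓ = ∀ (u v : Vertex G) → u ≢ v → weight ℓ u ≢ weight ℓ v

HasIrregularLabeling : ∀ {n} → Graph n → ℕ → Set
HasIrregularLabeling G k = Σ[ ℓ ∈ TotalLabeling G k ] VertexIrregular ℓ

-- tvs(G) = k, with the minimum given by its defining property.
IsTvs : ∀ {n} → Graph n → ℕ → Set
IsTvs G k =
  1 ℕ.≤ k ×
  HasIrregularLabeling G k ×
  (∀ j → 1 ℕ.≤ j → HasIrregularLabeling G j → k ℕ.≤ j)

-- Ceiling of the rational number m / k, as ⌊ (m + k - 1) / k ⌋.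
⌈_/_⌉ : (m k : ℕ) → .{{_ : NonZero k}} → ℕ
⌈ m / k ⌉ = (m + pred k) / k

{-# OPTIONS --safe #-}
-- Put s = ⌈(n + d)/(d + 1)⌉ - 1 and shift all labels to 0, …, s; weights then range over 0, …, (d + 1)s, and
-- the lower bound is counting. For the upper bound, fix a matching of 2m vertices with m linear in n, and
-- give its edges the label h = ⌊s/2⌋. Choose independent uniform x_v in {0, …, K - 1} and label any other edge uv
-- by s if x_u + x_v ≥ K ("heavy") and by 0 otherwise. A vertex on g heavy edges has edge sum s g + h b,
-- where b is 1 if it is matched and 0 if not. Reflecting x_v turns g into the rank of x_v in the closed
-- neighbourhood of v (minus the mate), so g is uniform up to ties, and by the Efron–Stein inequality some sample
-- has all its rank counts close to their expectations. Sorting the vertices by 2 g + b and taking positions as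
-- weights is admissible if the number of vertices in the classes below, resp. up to, a given one lies in the
-- right window of length s. Without the matching these windows are met only with equality in expectation;
-- the matched vertices create a slack linear in n, which absorbs the deviation.
module Submission where

open import Defs
open import Data.Bool using (T)
open import Data.Bool.Properties using (T?)
open import Data.Fin as Fin using (Fin; zero; suc; toℕ; fromℕ<; opposite; _↑ˡ_; _↑ʳ_)
open import Data.Fin.Permutation using (Permutation′; _⟨$⟩ʳ_; transpose; reverse)
import Data.Fin.Properties as Fin
open import Data.List using (List; []; _∷_; _++_; allFin; tabulate; cartesianProduct; filter; length; map; mapMaybe)
open import Data.List.Properties using (map-∘; map-cong; map-++; map-tabulate)
open import Data.Maybe as Maybe using (Maybe; just; nothing)
open import Data.Nat
open import Data.Nat.DivMod using (m≡m%n+[m/n]*n; m%n<n; m/n*n≤m; /-monoˡ-≤; m*n/n≡m; m<n*o⇒m/o<n; m/n≡0⇒m<n)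
import Data.Nat.ListAction as List
open import Data.Nat.ListAction.Properties using (sum-++)
open import Data.Nat.Properties
open import Data.Nat.Tactic.RingSolver using (solve-∀)
open import Data.Product using (∃; Σ-syntax; _×_; _,_; proj₁; proj₂)
open import Data.Sum using (_⊎_; inj₁; inj₂; [_,_]′; reduce)
open import Data.Vec using (Vec; []; _∷_; lookup; updateAt; _[_]≔_)
open import Data.Vec.Functional as Vector using (Vector)
open import Data.Vec.Functional.Properties using (lookup-++ˡ; lookup-++ʳ)
import Data.Vec.Functional.Relation.Unary.All.Properties as All
open import Data.Vec.Properties using (lookup∘update; lookup∘update′; lookup∘updateAt; lookup∘updateAt′)
open import Function using (_∘_; id)
open import Level using (0ℓ)
open import Relation.Binary.Definitions using (Total; Transitive; tri<; tri≈; tri>)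
open import Relation.Binary.PropositionalEquality
open import Relation.Nullary using (Dec; yes; no; ¬_; contradiction)
open import Relation.Nullary.Decidable using (_×-dec_; _⊎-dec_; ¬?; dec⇒maybe)
open import Relation.Unary using (Pred; Decidable)
import Algebra.Properties.CommutativeSemigroup +-commutativeSemigroup as +ₚ
open import Algebra.Properties.CommutativeSemigroup *-commutativeSemigroup using (x∙yz≈y∙xz; x∙yz≈xz∙y)
open import Algebra.Properties.Semiring.Sum +-*-semiring
  using (sum; ∑-distrib-+; ∑-comm; ∑-permute; *-distribˡ-sum; *-distribʳ-sum)
  renaming (sum-cong-≗ to ∑-cong)

-- Where the slack comes from. All edges of an unmatched vertex avoid the matching, so g takes d + 1
-- equally likely values up to ties; a matched vertex has only d - 1 such edges, so g takes d
-- values. Let p = 2m and scale counts by (d + 1) d. The number of vertices with 2 g + b < 2 i has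
-- mean d n i + p i, while an unmatched vertex with g = i needs about d n i below it: surplus p i.
-- The number with 2 g + b < 2 i + 1 has mean d n (i + 1) - p (d - i), while the same vertex allows
-- about d n (i + 1): surplus p (d - i). The surpluses vanish only at i = 0 and i = d, where the
-- requirements are trivial. The windows of matched vertices are shifted by h, about half a window,
-- so both their ends have slack of order n once p is a small fraction of n. Deviations are of order
-- sqrt n, because redrawing one x_v affects at most d + 1 heavy degrees. Everything stays in ℕ:
-- expectations are sums over the sample space, the factor (d + 1) d clears the denominators d + 1
-- and d, and K of order n makes all ties together cost at most one unit.

private variable
  n K : ℕ

-- Finite sums and counting

∑-mono : {f g : Fin n → ℕ} → (∀ i → f i ≤ g i) → sum f ≤ sum g
∑-mono {zero}  f≤g = z≤n
∑-mono {suc n} f≤g = +-mono-≤ (f≤g zero) (∑-mono (f≤g ∘ suc))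

∑-const : ∀ n c → sum {n} (λ _ → c) ≡ n * c
∑-const zero    c = refl
∑-const (suc n) c = cong (c +_) (∑-const n c)

term≤∑ : (f : Fin n → ℕ) → ∀ i → f i ≤ sum f
term≤∑ f zero    = m≤m+n _ _
term≤∑ f (suc i) = ≤-trans (term≤∑ (f ∘ suc) i) (m≤n+m _ _)

∑-positive : (f : Fin n → ℕ) → 1 ≤ sum f → ∃ λ i → 1 ≤ f i
∑-positive {suc n} f 1≤∑ with f zero in eq
... | suc _ = zero , subst (1 ≤_) (sym eq) (s≤s z≤n)
... | zero  with ∑-positive (f ∘ suc) 1≤∑
...   | i , 1≤fi = suc i , 1≤fi

∑-pigeonhole : ∀ n (f : Fin (suc n) → ℕ) {B} → sum f ≤ suc n * B → ∃ λ i → f i ≤ B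
∑-pigeonhole n f {B} ∑≤ with f zero ≤? B
... | yes f0≤B = zero , f0≤B
∑-pigeonhole zero f {B} ∑≤ | no f0≰B =
  contradiction (subst₂ _≤_ (+-identityʳ _) (+-identityʳ _) ∑≤) f0≰B
∑-pigeonhole (suc n) f {B} ∑≤ | no f0≰B
  with ∑-pigeonhole n (f ∘ suc) (+-cancelˡ-≤ B _ _ (≤-trans (+-monoˡ-≤ _ (≰⇒≥ f0≰B)) ∑≤))
... | i , fi≤B = suc i , fi≤B

𝟙 : ∀ {P : Set} → Dec P → ℕ
𝟙 (yes _) = 1
𝟙 (no _)  = 0

module _ {P : Set} where

  𝟙-yes : (P? : Dec P) → P → 𝟙 P? ≡ 1
  𝟙-yes (yes _) p = refl
  𝟙-yes (no ¬p) p = contradiction p ¬p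

  𝟙-no : (P? : Dec P) → ¬ P → 𝟙 P? ≡ 0
  𝟙-no (yes p) ¬p = contradiction p ¬p
  𝟙-no (no _)  ¬p = refl

  𝟙≤1 : (P? : Dec P) → 𝟙 P? ≤ 1
  𝟙≤1 (yes _) = ≤-refl
  𝟙≤1 (no _)  = z≤n

  𝟙-positive : (P? : Dec P) → 1 ≤ 𝟙 P? → P
  𝟙-positive (yes p) _ = p

  𝟙-≤ : (P? : Dec P) {m : ℕ} → (P → 1 ≤ m) → 𝟙 P? ≤ m
  𝟙-≤ (yes p) 1≤m = 1≤m p
  𝟙-≤ (no _)  _   = z≤n

module _ {P Q : Set} (P? : Dec P) (Q? : Dec Q) where

  𝟙-mono : (P → Q) → 𝟙 P? ≤ 𝟙 Q?
  𝟙-mono f = 𝟙-≤ P? (λ p → ≤-reflexive (sym (𝟙-yes Q? (f p))))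

𝟙-cong : ∀ {P Q : Set} (P? : Dec P) (Q? : Dec Q) → (P → Q) → (Q → P) → 𝟙 P? ≡ 𝟙 Q?
𝟙-cong P? Q? f g = ≤-antisym (𝟙-mono P? Q? f) (𝟙-mono Q? P? g)

𝟙-× : ∀ {P Q : Set} (P? : Dec P) (Q? : Dec Q) → 𝟙 (P? ×-dec Q?) ≡ 𝟙 P? * 𝟙 Q?
𝟙-× (yes _) (yes _) = refl
𝟙-× (yes _) (no _)  = refl
𝟙-× (no _)  _       = refl

# : {P : Pred (Fin n) 0ℓ} → Decidable P → ℕ
# P? = sum (λ i → 𝟙 (P? i))

module _ {P Q : Pred (Fin n) 0ℓ} (P? : Decidable P) (Q? : Decidable Q) where

  #-mono : (∀ i → P i → Q i) → # P? ≤ # Q?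
  #-mono P⇒Q = ∑-mono (λ i → 𝟙-mono (P? i) (Q? i) (P⇒Q i))

  #-cong : (∀ i → P i → Q i) → (∀ i → Q i → P i) → # P? ≡ # Q?
  #-cong P⇒Q Q⇒P = ∑-cong (λ i → 𝟙-cong (P? i) (Q? i) (P⇒Q i) (Q⇒P i))

∑-𝟙≡ : (f : Fin n → ℕ) (a : Fin n) → sum (λ i → 𝟙 (i Fin.≟ a) * f i) ≡ f a
∑-𝟙≡ {suc n} f zero = trans
  (cong₂ _+_ (+-identityʳ (f zero)) (trans (∑-const n 0) (*-zeroʳ n)))
  (+-identityʳ (f zero))
∑-𝟙≡ f (suc a) = trans
  (∑-cong (λ i → cong (_* f (suc i)) (𝟙-cong (suc i Fin.≟ suc a) (i Fin.≟ a) Fin.suc-injective (cong suc))))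
  (∑-𝟙≡ (f ∘ suc) a)

#-≡ : (a : Fin n) → # (Fin._≟ a) ≡ 1
#-≡ a = trans (∑-cong (λ i → sym (*-identityʳ (𝟙 (i Fin.≟ a))))) (∑-𝟙≡ (λ _ → 1) a)

#-mono-except : {P Q : Pred (Fin n) 0ℓ} (P? : Decidable P) (Q? : Decidable Q) (a : Fin n) →
                (∀ i → P i → i ≡ a ⊎ Q i) → # P? ≤ suc (# Q?)
#-mono-except P? Q? a P⇒ = begin
  # P?                                     ≤⟨ ∑-mono (λ i → 𝟙-≤ (P? i) (aux i)) ⟩
  sum (λ i → 𝟙 (i Fin.≟ a) + 𝟙 (Q? i))     ≡⟨ ∑-distrib-+ (λ i → 𝟙 (i Fin.≟ a)) (λ i → 𝟙 (Q? i)) ⟩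
  # (Fin._≟ a) + # Q?                      ≡⟨ cong (_+ # Q?) (#-≡ a) ⟩
  suc (# Q?)                               ∎
  where
  open ≤-Reasoning
  aux : ∀ i → _ → 1 ≤ 𝟙 (i Fin.≟ a) + 𝟙 (Q? i)
  aux i p with P⇒ i p
  ... | inj₁ i≡a = m≤n⇒m≤n+o _ (≤-reflexive (sym (𝟙-yes (i Fin.≟ a) i≡a)))
  ... | inj₂ q   = m≤n⇒m≤o+n _ (≤-reflexive (sym (𝟙-yes (Q? i) q)))

#-mono-< : {P Q : Pred (Fin n) 0ℓ} (P? : Decidable P) (Q? : Decidable Q) (a : Fin n) →
           ¬ P a → Q a → (∀ i → P i → Q i) → # P? < # Q?
#-mono-< P? Q? a ¬Pa Qa P⇒Q = begin-strict
  # P?                                   <⟨ n<1+n _ ⟩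
  suc (# P?)                             ≡⟨ cong (_+ # P?) (#-≡ a) ⟨
  # (Fin._≟ a) + # P?                    ≡⟨ ∑-distrib-+ (λ i → 𝟙 (i Fin.≟ a)) (λ i → 𝟙 (P? i)) ⟨
  sum (λ i → 𝟙 (i Fin.≟ a) + 𝟙 (P? i))   ≤⟨ ∑-mono aux ⟩
  # Q?                                   ∎
  where
  open ≤-Reasoning
  aux : ∀ i → 𝟙 (i Fin.≟ a) + 𝟙 (P? i) ≤ 𝟙 (Q? i)
  aux i with i Fin.≟ a
  ... | yes refl = ≤-reflexive (trans (cong suc (𝟙-no (P? i) ¬Pa)) (sym (𝟙-yes (Q? i) Qa)))
  ... | no  _    = 𝟙-mono (P? i) (Q? i) (P⇒Q i)

-- Kept generic in the order so that one induction yields maximisers for `_≤_` and minimisers for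
-- `_≥_`. Reflexivity is extracted from totality by `reduce`.
extremum : {_≼_ : ℕ → ℕ → Set} → Total _≼_ → Transitive _≼_ →
           {P : Pred (Fin n) 0ℓ} (P? : Decidable P) (f : Fin n → ℕ) →
           (∀ i → ¬ P i) ⊎ ∃ λ i → P i × (∀ j → P j → f j ≼ f i)
extremum {zero}  total ≼-trans P? f = inj₁ (λ ())
extremum {suc n} total ≼-trans P? f with P? zero | extremum total ≼-trans (P? ∘ suc) (f ∘ suc)
... | no ¬P0 | inj₁ none = inj₁ λ { zero → ¬P0 ; (suc i) → none i }
... | no ¬P0 | inj₂ (i , Pi , max) =
  inj₂ (suc i , Pi , λ { zero P0 → contradiction P0 ¬P0 ; (suc j) → max j })
... | yes P0 | inj₁ none =
  inj₂ (zero , P0 , λ { zero _ → reduce (total (f zero) (f zero)) ; (suc j) Pj → contradiction Pj (none j) })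
... | yes P0 | inj₂ (i , Pi , max) with total (f zero) (f (suc i))
...   | inj₁ f0≼ = inj₂ (suc i , Pi , λ { zero _ → f0≼ ; (suc j) → max j })
...   | inj₂ ≼f0 = inj₂ (zero , P0 , λ { zero _ → reduce (total (f zero) (f zero))
                                       ; (suc j) Pj → ≼-trans (max j Pj) ≼f0 })

-- Concentration in product spaces

-- The sum over all vectors: an expectation without the factor 1 / K ^ n.
𝔼 : (Vec (Fin K) n → ℕ) → ℕ
𝔼 {n = zero}  g = g []
𝔼 {n = suc n} g = sum (λ a → 𝔼 (λ x → g (a ∷ x)))

𝔼-cong : {f g : Vec (Fin K) n → ℕ} → (∀ x → f x ≡ g x) → 𝔼 f ≡ 𝔼 g
𝔼-cong {n = zero}  f≗g = f≗g []
𝔼-cong {n = suc n} f≗g = ∑-cong (λ a → 𝔼-cong (λ x → f≗g (a ∷ x)))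

𝔼-mono : {f g : Vec (Fin K) n → ℕ} → (∀ x → f x ≤ g x) → 𝔼 f ≤ 𝔼 g
𝔼-mono {n = zero}  f≤g = f≤g []
𝔼-mono {n = suc n} f≤g = ∑-mono (λ a → 𝔼-mono (λ x → f≤g (a ∷ x)))

𝔼-+ : (f g : Vec (Fin K) n → ℕ) → 𝔼 (λ x → f x + g x) ≡ 𝔼 f + 𝔼 g
𝔼-+ {n = zero}  f g = refl
𝔼-+ {n = suc n} f g = trans
  (∑-cong (λ a → 𝔼-+ (λ x → f (a ∷ x)) (λ x → g (a ∷ x))))
  (∑-distrib-+ (λ a → 𝔼 (λ x → f (a ∷ x))) (λ a → 𝔼 (λ x → g (a ∷ x))))

𝔼-* : ∀ c (f : Vec (Fin K) n → ℕ) → 𝔼 (λ x → c * f x) ≡ c * 𝔼 f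
𝔼-* {n = zero}  c f = refl
𝔼-* {n = suc n} c f = trans (∑-cong (λ a → 𝔼-* c (λ x → f (a ∷ x)))) (sym (*-distribˡ-sum c (λ a → 𝔼 (λ x → f (a ∷ x)))))

𝔼-const : ∀ c → 𝔼 {K} {n} (λ _ → c) ≡ K ^ n * c
𝔼-const {n = zero}      c = sym (+-identityʳ c)
𝔼-const {K} {suc n} c = begin
  sum {K} (λ a → 𝔼 {K} {n} (λ _ → c))  ≡⟨ ∑-const K _ ⟩
  K * 𝔼 {K} {n} (λ _ → c)              ≡⟨ cong (K *_) (𝔼-const {K} {n} c) ⟩
  K * (K ^ n * c)                      ≡⟨ *-assoc K (K ^ n) c ⟨
  K ^ suc n * c                        ∎
  where open ≡-Reasoning

𝔼-∑ : ∀ {m} (f : Fin m → Vec (Fin K) n → ℕ) → 𝔼 (λ x → sum (λ i → f i x)) ≡ sum (λ i → 𝔼 (f i))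
𝔼-∑ {n = zero}  f = refl
𝔼-∑ {n = suc n} f = trans (∑-cong (λ a → 𝔼-∑ (λ i x → f i (a ∷ x)))) (∑-comm (λ a i → 𝔼 (λ x → f i (a ∷ x))))

-- Averaging, one coordinate at a time. Writing the range as `suc K` keeps the sample space
-- nonempty.
𝔼-pigeonhole : (f : Vec (Fin (suc K)) n → ℕ) {B : ℕ} → 𝔼 f ≤ suc K ^ n * B → ∃ λ x → f x ≤ B
𝔼-pigeonhole {n = zero}  f 𝔼≤ = [] , ≤-trans 𝔼≤ (≤-reflexive (+-identityʳ _))
𝔼-pigeonhole {K} {suc n} f {B} 𝔼≤
  with a , le ← ∑-pigeonhole K _ (≤-trans 𝔼≤ (≤-reflexive (*-assoc (suc K) (suc K ^ n) B)))
  with x , fx≤B ← 𝔼-pigeonhole (λ x → f (a ∷ x)) le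
  = a ∷ x , fx≤B

𝔼-permuteAt : (π : Permutation′ K) (v : Fin n) (g : Vec (Fin K) n → ℕ) →
              𝔼 (λ x → g (updateAt x v (π ⟨$⟩ʳ_))) ≡ 𝔼 g
𝔼-permuteAt π zero    g = sym (∑-permute (λ a → 𝔼 (λ x → g (a ∷ x))) π)
𝔼-permuteAt π (suc v) g = ∑-cong (λ a → 𝔼-permuteAt π v (λ x → g (a ∷ x)))

-- Redrawing coordinate v leaves the distribution unchanged; the factor K counts the overwritten old
-- values.
𝔼-resample : (v : Fin n) (g : Vec (Fin K) n → ℕ) →
             𝔼 (λ x → sum (λ a → g (x [ v ]≔ a))) ≡ K * 𝔼 g
𝔼-resample {suc n} {K} zero g = begin
  sum {K} (λ b → 𝔼 (λ x → sum (λ a → g (a ∷ x))))  ≡⟨ ∑-const K _ ⟩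
  K * 𝔼 (λ x → sum (λ a → g (a ∷ x)))              ≡⟨ cong (K *_) (𝔼-∑ (λ a x → g (a ∷ x))) ⟩
  K * 𝔼 g                                          ∎
  where open ≡-Reasoning
𝔼-resample {suc n} {K} (suc v) g = trans
  (∑-cong (λ a → 𝔼-resample v (λ x → g (a ∷ x))))
  (sym (*-distribˡ-sum K (λ a → 𝔼 (λ x → g (a ∷ x)))))

swapAt : Fin n → Fin n → Vec (Fin K) n → Vec (Fin K) n
swapAt i j x = (x [ i ]≔ lookup x j) [ j ]≔ lookup x i

-- The old value at v and an independent fresh value form an exchangeable pair: on the left the old
-- value is handed to φ and the fresh one sits in the vector, on the right the roles are reversed.
𝔼-exchange : (v : Fin n) (φ : Fin K → Vec (Fin K) n → ℕ) →
             𝔼 (λ x → sum (λ a → φ (lookup x v) (x [ v ]≔ a))) ≡ 𝔼 (λ x → sum (λ a → φ a x))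
𝔼-exchange {suc n} {K} zero φ = begin
  sum (λ b → 𝔼 (λ x → sum (λ a → φ b (a ∷ x))))    ≡⟨ ∑-cong (λ b → 𝔼-∑ (λ a x → φ b (a ∷ x))) ⟩
  sum (λ b → sum (λ a → 𝔼 (λ x → φ b (a ∷ x))))    ≡⟨ ∑-comm (λ b a → 𝔼 (λ x → φ b (a ∷ x))) ⟩
  sum (λ a → sum (λ b → 𝔼 (λ x → φ b (a ∷ x))))    ≡⟨ ∑-cong (λ a → 𝔼-∑ (λ b x → φ b (a ∷ x))) ⟨
  sum (λ a → 𝔼 (λ x → sum (λ b → φ b (a ∷ x))))    ∎
  where open ≡-Reasoning
𝔼-exchange (suc v) φ = ∑-cong (λ b → 𝔼-exchange v (λ a x → φ a (b ∷ x)))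

𝔼-swapAt : (i j : Fin n) (g : Vec (Fin K) n → ℕ) → 𝔼 (λ x → g (swapAt i j x)) ≡ 𝔼 g
𝔼-swapAt zero    zero    g = refl
𝔼-swapAt zero    (suc j) g = 𝔼-swapHead j g
  where
  -- The head of a vector is a fresh value independent of the tail, so swapping it with entry j is
  -- an instance of `𝔼-exchange`.
  𝔼-swapHead : ∀ {n} (j : Fin n) (g : Vec _ (suc n) → ℕ) →
               sum (λ a → 𝔼 (λ x → g (lookup x j ∷ (x [ j ]≔ a)))) ≡ 𝔼 g
  𝔼-swapHead j g = begin
    sum (λ a → 𝔼 (λ x → g (lookup x j ∷ (x [ j ]≔ a))))  ≡⟨ 𝔼-∑ (λ a x → g (lookup x j ∷ (x [ j ]≔ a))) ⟨
    𝔼 (λ x → sum (λ a → g (lookup x j ∷ (x [ j ]≔ a))))  ≡⟨ 𝔼-exchange j (λ a x → g (a ∷ x)) ⟩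
    𝔼 (λ x → sum (λ a → g (a ∷ x)))                      ≡⟨ 𝔼-∑ (λ a x → g (a ∷ x)) ⟩
    𝔼 g                                                  ∎
    where open ≡-Reasoning
𝔼-swapAt (suc i) zero    g = 𝔼-swapAt zero (suc i) g
𝔼-swapAt (suc i) (suc j) g = ∑-cong (λ a → 𝔼-swapAt i j (λ x → g (a ∷ x)))

-- This is (a - b)² ≤ c² with the cross term moved to the right to avoid subtraction.
square-near : ∀ {a b c} → a ≤ b + c → b ≤ a + c → a * a + b * b ≤ 2 * (a * b) + c * c
square-near {a} {b} {c} a≤b+c b≤a+c with ≤-total a b
... | inj₁ a≤b with δ , refl ← m≤n⇒∃[o]m+o≡n a≤b = begin
  a * a + (a + δ) * (a + δ)      ≡⟨ expand a δ ⟩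
  2 * (a * (a + δ)) + δ * δ      ≤⟨ +-monoʳ-≤ (2 * (a * (a + δ))) (*-mono-≤ δ≤c δ≤c) ⟩
  2 * (a * (a + δ)) + c * c      ∎
  where
  open ≤-Reasoning
  δ≤c : δ ≤ c
  δ≤c = +-cancelˡ-≤ a δ c b≤a+c
  expand : ∀ a δ → a * a + (a + δ) * (a + δ) ≡ 2 * (a * (a + δ)) + δ * δ
  expand = solve-∀
square-near {a} {b} {c} a≤b+c b≤a+c | inj₂ b≤a with δ , refl ← m≤n⇒∃[o]m+o≡n b≤a = begin
  (b + δ) * (b + δ) + b * b      ≡⟨ expand b δ ⟩
  2 * ((b + δ) * b) + δ * δ      ≤⟨ +-monoʳ-≤ (2 * ((b + δ) * b)) (*-mono-≤ δ≤c δ≤c) ⟩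
  2 * ((b + δ) * b) + c * c      ∎
  where
  open ≤-Reasoning
  δ≤c : δ ≤ c
  δ≤c = +-cancelˡ-≤ b δ c a≤b+c
  expand : ∀ b δ → (b + δ) * (b + δ) + b * b ≡ 2 * ((b + δ) * b) + δ * δ
  expand = solve-∀

∑-∑-+ : ∀ {m n} (f g : Fin m → Fin n → ℕ) →
        sum (λ i → sum (λ j → f i j + g i j)) ≡ sum (λ i → sum (f i)) + sum (λ i → sum (g i))
∑-∑-+ f g = trans (∑-cong (λ i → ∑-distrib-+ (f i) (g i)))
                  (∑-distrib-+ (λ i → sum (f i)) (λ i → sum (g i)))

∑-*-∑ : ∀ {m n} (f : Fin m → ℕ) (g : Fin n → ℕ) →
        sum (λ i → sum (λ j → f i * g j)) ≡ sum f * sum g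
∑-*-∑ f g = trans (∑-cong (λ i → sym (*-distribˡ-sum (f i) g))) (sym (*-distribʳ-sum (sum g) f))

-- Rests on the identity 2 (K Σ f² - (Σ f)²) = Σ (f i - f j)² over all ordered pairs, each term
-- being at most c².
∑-variance : (f : Fin K → ℕ) {c : ℕ} → (∀ i j → f i ≤ f j + c) →
             K * sum (λ i → f i * f i) ≤ sum f * sum f + K * K * (c * c)
∑-variance {K} f {c} near = *-cancelˡ-≤ 2 (begin
  2 * (K * S₂)                                            ≡⟨ cong (K * S₂ +_) (+-identityʳ (K * S₂)) ⟩
  K * S₂ + K * S₂                                         ≡⟨ cong₂ _+_ (*-distribˡ-sum K (λ i → f i * f i)) (sym (∑-const K S₂)) ⟩
  sum (λ i → K * (f i * f i)) + sum {K} (λ _ → S₂)        ≡⟨ cong (_+ sum {K} (λ _ → S₂)) (∑-cong (λ i → ∑-const K (f i * f i))) ⟨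
  sum (λ i → sum {K} (λ _ → f i * f i)) + sum {K} (λ _ → S₂)
                                                          ≡⟨ ∑-∑-+ (λ i j → f i * f i) (λ i j → f j * f j) ⟨
  sum (λ i → sum (λ j → f i * f i + f j * f j))           ≤⟨ ∑-mono (λ i → ∑-mono (λ j → square-near (near i j) (near j i))) ⟩
  sum (λ i → sum (λ j → 2 * (f i * f j) + c * c))         ≡⟨ ∑-∑-+ (λ i j → 2 * (f i * f j)) (λ i j → c * c) ⟩
  sum (λ i → sum (λ j → 2 * (f i * f j))) + sum {K} (λ i → sum {K} (λ j → c * c))
                                                          ≡⟨ cong₂ _+_ double constant ⟩
  -- A factor 2 in the error is given away here, so that the 2 on the left can be cancelled.
  2 * (sum f * sum f) + K * K * (c * c)                   ≤⟨ +-monoʳ-≤ (2 * (sum f * sum f)) (m≤m+n (K * K * (c * c)) _) ⟩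
  2 * (sum f * sum f) + 2 * (K * K * (c * c))             ≡⟨ *-distribˡ-+ 2 (sum f * sum f) (K * K * (c * c)) ⟨
  2 * (sum f * sum f + K * K * (c * c))                   ∎)
  where
  open ≤-Reasoning
  S₂ = sum (λ i → f i * f i)
  double : sum (λ i → sum (λ j → 2 * (f i * f j))) ≡ 2 * (sum f * sum f)
  double = trans (∑-cong (λ i → sym (*-distribˡ-sum 2 (λ j → f i * f j))))
    (trans (sym (*-distribˡ-sum 2 (λ i → sum (λ j → f i * f j)))) (cong (2 *_) (∑-*-∑ f f)))
  constant : sum {K} (λ i → sum {K} (λ j → c * c)) ≡ K * K * (c * c)
  constant = trans (∑-cong {K} (λ i → ∑-const K (c * c)))
    (trans (∑-const K (K * (c * c))) (sym (*-assoc K K (c * c))))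

Lipschitz : ℕ → (Vec (Fin K) n → ℕ) → Set
Lipschitz c f = ∀ x v a → f (x [ v ]≔ a) ≤ f x + c

-- The Efron–Stein inequality, by induction on the number of coordinates.
𝔼-variance : ∀ {c} (f : Vec (Fin K) n → ℕ) → Lipschitz c f →
             K ^ n * 𝔼 (λ x → f x * f x) ≤ 𝔼 f * 𝔼 f + n * (c * c) * (K ^ n * K ^ n)
𝔼-variance {n = zero}  f lip = ≤-reflexive (trans (+-identityʳ _) (sym (+-identityʳ _)))
𝔼-variance {K} {suc n} {c} f lip = begin
  K * N * sum (λ a → 𝔼 (λ x → f (a ∷ x) * f (a ∷ x)))
    ≡⟨ trans (*-assoc K N _) (cong (K *_) (*-distribˡ-sum N (λ a → 𝔼 (λ x → f (a ∷ x) * f (a ∷ x))))) ⟩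
  K * sum (λ a → N * 𝔼 (λ x → f (a ∷ x) * f (a ∷ x)))
    ≤⟨ *-monoʳ-≤ K (∑-mono (λ a → 𝔼-variance (λ x → f (a ∷ x)) (λ x v → lip (a ∷ x) (suc v)))) ⟩
  K * sum (λ a → m a * m a + E)
    ≡⟨ cong (K *_) (trans (∑-distrib-+ (λ a → m a * m a) (λ _ → E)) (cong (sum (λ a → m a * m a) +_) (∑-const K E))) ⟩
  K * (sum (λ a → m a * m a) + K * E)
    ≡⟨ *-distribˡ-+ K (sum (λ a → m a * m a)) (K * E) ⟩
  K * sum (λ a → m a * m a) + K * (K * E)
    -- The induction hypothesis handled the variance within each value of the first coordinate; this
    -- is the variance between the conditional sums `m a`, any two of which differ by at most
    -- `N * c`.
    ≤⟨ +-monoˡ-≤ (K * (K * E)) (∑-variance m near) ⟩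
  sum m * sum m + K * K * ((N * c) * (N * c)) + K * (K * E)
    ≡⟨ regroup (sum m * sum m) K N c n ⟩
  sum m * sum m + suc n * (c * c) * ((K * N) * (K * N)) ∎
  where
  open ≤-Reasoning
  N = K ^ n
  E = n * (c * c) * (N * N)
  m : Fin K → ℕ
  m a = 𝔼 (λ x → f (a ∷ x))
  near : ∀ a b → m a ≤ m b + N * c
  near a b = begin
    m a                            ≤⟨ 𝔼-mono (λ x → lip (b ∷ x) zero a) ⟩
    𝔼 (λ x → f (b ∷ x) + c)        ≡⟨ 𝔼-+ (λ x → f (b ∷ x)) (λ _ → c) ⟩
    m b + 𝔼 {K} {n} (λ _ → c)      ≡⟨ cong (m b +_) (𝔼-const {K} {n} c) ⟩
    m b + N * c                    ∎
  regroup : ∀ M K N c n → M + K * K * ((N * c) * (N * c)) + K * (K * (n * (c * c) * (N * N)))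
                        ≡ M + (c * c + n * (c * c)) * ((K * N) * (K * N))
  regroup = solve-∀

square-distance : ∀ a b → ∣ a - b ∣ * ∣ a - b ∣ + 2 * (a * b) ≡ a * a + b * b
square-distance a b with ≤-total a b
... | inj₁ a≤b with δ , refl ← m≤n⇒∃[o]m+o≡n a≤b =
  trans (cong (λ e → e * e + 2 * (a * (a + δ))) (∣m-m+n∣≡n a δ)) (expand a δ)
  where
  expand : ∀ a δ → δ * δ + 2 * (a * (a + δ)) ≡ a * a + (a + δ) * (a + δ)
  expand = solve-∀
... | inj₂ b≤a with δ , refl ← m≤n⇒∃[o]m+o≡n b≤a =
  trans (cong (λ e → e * e + 2 * ((b + δ) * b)) (trans (∣-∣-comm (b + δ) b) (∣m-m+n∣≡n b δ))) (expand b δ)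
  where
  expand : ∀ b δ → δ * δ + 2 * ((b + δ) * b) ≡ (b + δ) * (b + δ) + b * b
  expand = solve-∀

-- The second moment about t is the variance plus the squared bias. The normalised mean lies between
-- t and t + 1, so the bias adds at most 1, which is the `suc`.
second-moment : ∀ {c} (f : Vec (Fin (suc K)) n → ℕ) → Lipschitz c f → ∀ t →
                suc K ^ n * t ≤ 𝔼 f → 𝔼 f ≤ suc K ^ n * t + suc K ^ n →
                𝔼 (λ x → ∣ f x - t ∣ * ∣ f x - t ∣) ≤ suc K ^ n * suc (n * (c * c))
second-moment {K} {n} {c} f lip t lower upper =
  *-cancelˡ-≤ N {{m^n≢0 (suc K) n}} (+-cancelʳ-≤ (2 * (𝔼 f * (N * t))) _ _ (begin
    N * V + 2 * (𝔼 f * (N * t))          ≡⟨ factor N V (𝔼 f) t ⟩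
    N * (V + 2 * t * 𝔼 f)                ≡⟨ cong (N *_) moments ⟩
    N * (𝔼 (λ x → f x * f x) + N * (t * t))
                                         ≡⟨ *-distribˡ-+ N (𝔼 (λ x → f x * f x)) (N * (t * t)) ⟩
    N * 𝔼 (λ x → f x * f x) + N * (N * (t * t))
                                         ≤⟨ +-monoˡ-≤ (N * (N * (t * t))) (𝔼-variance f lip) ⟩
    𝔼 f * 𝔼 f + n * (c * c) * (N * N) + N * (N * (t * t))
                                         ≡⟨ regroup₁ (𝔼 f) n c N t ⟩
    𝔼 f * 𝔼 f + (N * t) * (N * t) + n * (c * c) * (N * N)
                                         ≤⟨ +-monoˡ-≤ (n * (c * c) * (N * N)) (square-near upper (≤-trans lower (m≤m+n (𝔼 f) N))) ⟩
    2 * (𝔼 f * (N * t)) + N * N + n * (c * c) * (N * N)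
                                         ≡⟨ regroup₂ (2 * (𝔼 f * (N * t))) N n c ⟩
    N * (N * suc (n * (c * c))) + 2 * (𝔼 f * (N * t)) ∎))
  where
  open ≤-Reasoning
  N = suc K ^ n
  V = 𝔼 (λ x → ∣ f x - t ∣ * ∣ f x - t ∣)
  factor : ∀ N V F t → N * V + 2 * (F * (N * t)) ≡ N * (V + 2 * t * F)
  factor = solve-∀
  regroup₁ : ∀ F n c N t → F * F + n * (c * c) * (N * N) + N * (N * (t * t))
                         ≡ F * F + (N * t) * (N * t) + n * (c * c) * (N * N)
  regroup₁ = solve-∀
  regroup₂ : ∀ A N n c → A + N * N + n * (c * c) * (N * N) ≡ N * (N * (1 + n * (c * c))) + A
  regroup₂ = solve-∀
  reorder : ∀ a t → 2 * (a * t) ≡ 2 * t * a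
  reorder = solve-∀
  moments : V + 2 * t * 𝔼 f ≡ 𝔼 (λ x → f x * f x) + N * (t * t)
  moments = begin-equality
    V + 2 * t * 𝔼 f                              ≡⟨ cong (V +_) (𝔼-* (2 * t) f) ⟨
    V + 𝔼 (λ x → 2 * t * f x)                    ≡⟨ 𝔼-+ (λ x → ∣ f x - t ∣ * ∣ f x - t ∣) (λ x → 2 * t * f x) ⟨
    𝔼 (λ x → ∣ f x - t ∣ * ∣ f x - t ∣ + 2 * t * f x)
      ≡⟨ 𝔼-cong (λ x → trans (cong (∣ f x - t ∣ * ∣ f x - t ∣ +_) (sym (reorder (f x) t))) (square-distance (f x) t)) ⟩
    𝔼 (λ x → f x * f x + t * t)                  ≡⟨ 𝔼-+ (λ x → f x * f x) (λ _ → t * t) ⟩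
    𝔼 (λ x → f x * f x) + 𝔼 {suc K} {n} (λ _ → t * t)
                                                 ≡⟨ cong (𝔼 (λ x → f x * f x) +_) (𝔼-const {suc K} {n} (t * t)) ⟩
    𝔼 (λ x → f x * f x) + N * (t * t)            ∎

square-cancel : ∀ {a b} → a * a ≤ b * b → a ≤ b
square-cancel {a} {b} a²≤b² with a ≤? b
... | yes a≤b = a≤b
... | no  a≰b = contradiction a²≤b² (<⇒≱ (*-mono-< (≰⇒> a≰b) (≰⇒> a≰b)))

-- The squared deviations of all r functions are added up before averaging. A sample at or below the
-- mean of this total keeps every single square at most `T * T`, so one sample serves all functions
-- at once.
concentration : ∀ {r c} (f : Fin r → Vec (Fin (suc K)) n → ℕ) → (∀ i → Lipschitz c (f i)) →
                (t : Fin r → ℕ) →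
                (∀ i → suc K ^ n * t i ≤ 𝔼 (f i)) → (∀ i → 𝔼 (f i) ≤ suc K ^ n * t i + suc K ^ n) →
                ∀ T → r * suc (n * (c * c)) ≤ T * T →
                ∃ λ x → ∀ i → ∣ f i x - t i ∣ ≤ T
concentration {K} {n} {r} {c} f lip t lower upper T bound = result
  where
  open ≤-Reasoning
  N = suc K ^ n
  sq : Fin r → Vec (Fin (suc K)) n → ℕ
  sq i x = ∣ f i x - t i ∣ * ∣ f i x - t i ∣
  total : 𝔼 (λ x → sum (λ i → sq i x)) ≤ N * (r * suc (n * (c * c)))
  total = begin
    𝔼 (λ x → sum (λ i → sq i x))              ≡⟨ 𝔼-∑ sq ⟩
    sum (λ i → 𝔼 (sq i))                      ≤⟨ ∑-mono (λ i → second-moment (f i) (lip i) (t i) (lower i) (upper i)) ⟩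
    sum {r} (λ i → N * suc (n * (c * c)))     ≡⟨ ∑-const r (N * suc (n * (c * c))) ⟩
    r * (N * suc (n * (c * c)))               ≡⟨ x∙yz≈y∙xz r N (suc (n * (c * c))) ⟩
    N * (r * suc (n * (c * c)))               ∎
  result : ∃ λ x → ∀ i → ∣ f i x - t i ∣ ≤ T
  result with x , small ← 𝔼-pigeonhole (λ x → sum (λ i → sq i x)) total =
    x , λ i → square-cancel (≤-trans (term≤∑ (λ i → sq i x) i) (≤-trans small bound))

-- Ranks in a random sample

module _ {P : Pred (Fin n) 0ℓ} (P? : Decidable P) (f : Fin n → ℕ) where

  #above : Fin n → ℕ
  #above i = # (λ u → P? u ×-dec (f i <? f u))

  -- However ties are broken, the number of other members of P ranked ahead of a member i lies
  -- between `#above i` and `#level i`. The former gives the clean lower bound on rank counts, the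
  -- latter the clean upper bound.
  #level : Fin n → ℕ
  #level i = # (λ u → P? u ×-dec (f i ≤? f u) ×-dec ¬? (u Fin.≟ i))

  #ties : Fin n → ℕ
  #ties i = # (λ u → P? u ×-dec (f u ≟ f i) ×-dec ¬? (u Fin.≟ i))

  -- Among the members with at least θ others strictly above them, take one with the largest value:
  -- all members strictly above it have rank count below θ, and there are at least θ of them.
  #-#above<-lower : ∀ {θ} → θ ≤ # P? → θ ≤ # (λ i → P? i ×-dec (#above i <? θ))
  #-#above<-lower {θ} θ≤ with extremum ≤-total ≤-trans (λ i → P? i ×-dec ¬? (#above i <? θ)) f
  ... | inj₁ none = ≤-trans θ≤ (#-mono P? (λ i → P? i ×-dec (#above i <? θ)) all)
    where
    all : ∀ i → P i → P i × #above i < θ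
    all i p with #above i <? θ
    ... | yes <θ = p , <θ
    ... | no ≮θ  = contradiction (p , ≮θ) (none i)
  ... | inj₂ (i , (_ , ≮θ) , max) =
    ≤-trans (≮⇒≥ ≮θ) (#-mono (λ u → P? u ×-dec (f i <? f u)) (λ u → P? u ×-dec (#above u <? θ)) high)
    where
    high : ∀ u → P u × f i < f u → P u × #above u < θ
    high u (p , i<u) with #above u <? θ
    ... | yes <θ = p , <θ
    ... | no u≮θ = contradiction (max u (p , u≮θ)) (<⇒≱ i<u)

  -- Take the lowest counted member i. Every other counted member lies at or above it, so their
  -- number is at most `#level i`, which is less than θ.
  #-#level<-upper : ∀ θ → # (λ i → P? i ×-dec (#level i <? θ)) ≤ θ
  #-#level<-upper θ with extremum {_≼_ = _≥_} (λ a b → ≤-total b a) (λ p q → ≤-trans q p)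
                                  (λ i → P? i ×-dec (#level i <? θ)) f
  ... | inj₁ none = subst (_≤ θ) (sym empty) z≤n
    where
    empty : # (λ i → P? i ×-dec (#level i <? θ)) ≡ 0
    empty = trans (∑-cong (λ i → 𝟙-no (P? i ×-dec (#level i <? θ)) (none i))) (trans (∑-const n 0) (*-zeroʳ n))
  ... | inj₂ (i , (_ , <θ) , min) = ≤-trans
    (#-mono-except (λ u → P? u ×-dec (#level u <? θ)) (λ u → P? u ×-dec (f i ≤? f u) ×-dec ¬? (u Fin.≟ i)) i split) <θ
    where
    split : ∀ u → P u × #level u < θ → u ≡ i ⊎ (P u × f i ≤ f u × u ≢ i)
    split u Pu with u Fin.≟ i
    ... | yes u≡i = inj₁ u≡i
    ... | no  u≢i = inj₂ (proj₁ Pu , min u Pu , u≢i)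

  #level≤#above+#ties : ∀ i → #level i ≤ #above i + #ties i
  #level≤#above+#ties i = ≤-trans (∑-mono pointwise) (≤-reflexive
    (∑-distrib-+ (λ u → 𝟙 (P? u ×-dec (f i <? f u))) (λ u → 𝟙 (P? u ×-dec (f u ≟ f i) ×-dec ¬? (u Fin.≟ i)))))
    where
    pointwise : ∀ u → 𝟙 (P? u ×-dec (f i ≤? f u) ×-dec ¬? (u Fin.≟ i)) ≤
                      𝟙 (P? u ×-dec (f i <? f u)) + 𝟙 (P? u ×-dec (f u ≟ f i) ×-dec ¬? (u Fin.≟ i))
    pointwise u = 𝟙-≤ (P? u ×-dec (f i ≤? f u) ×-dec ¬? (u Fin.≟ i)) λ (p , i≤u , u≢i) → aux p u≢i (m≤n⇒m<n∨m≡n i≤u)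
      where
      aux : P u → u ≢ i → f i < f u ⊎ f i ≡ f u → _
      aux p u≢i (inj₁ i<u) = m≤n⇒m≤n+o _ (≤-reflexive (sym (𝟙-yes (P? u ×-dec (f i <? f u)) (p , i<u))))
      aux p u≢i (inj₂ i≡u) = m≤n⇒m≤o+n (𝟙 (P? u ×-dec (f i <? f u)))
        (≤-reflexive (sym (𝟙-yes (P? u ×-dec (f u ≟ f i) ×-dec ¬? (u Fin.≟ i)) (p , sym i≡u , u≢i))))

  -- A member counted through `#above` but not through `#level` has at least one tie, so it is
  -- charged to its own tie count.
  #-#above<-upper : ∀ θ → # (λ i → P? i ×-dec (#above i <? θ)) ≤ θ + sum (λ i → 𝟙 (P? i) * #ties i)
  #-#above<-upper θ = begin
    # (λ i → P? i ×-dec (#above i <? θ))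
      ≤⟨ ∑-mono pointwise ⟩
    sum (λ i → 𝟙 (P? i ×-dec (#level i <? θ)) + 𝟙 (P? i) * #ties i)
      ≡⟨ ∑-distrib-+ (λ i → 𝟙 (P? i ×-dec (#level i <? θ))) (λ i → 𝟙 (P? i) * #ties i) ⟩
    # (λ i → P? i ×-dec (#level i <? θ)) + sum (λ i → 𝟙 (P? i) * #ties i)
      ≤⟨ +-monoˡ-≤ _ (#-#level<-upper θ) ⟩
    θ + sum (λ i → 𝟙 (P? i) * #ties i) ∎
    where
    open ≤-Reasoning
    pointwise : ∀ i → 𝟙 (P? i ×-dec (#above i <? θ)) ≤ 𝟙 (P? i ×-dec (#level i <? θ)) + 𝟙 (P? i) * #ties i
    pointwise i = 𝟙-≤ (P? i ×-dec (#above i <? θ)) aux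
      where
      aux : P i × #above i < θ → 1 ≤ 𝟙 (P? i ×-dec (#level i <? θ)) + 𝟙 (P? i) * #ties i
      aux (p , <θ) with #level i <? θ
      ... | yes l<θ = m≤n⇒m≤n+o _ (≤-reflexive (sym (𝟙-yes (P? i ×-dec yes l<θ) (p , l<θ))))
      ... | no  l≮θ = m≤n⇒m≤o+n (𝟙 (P? i ×-dec no l≮θ)) (subst (λ c → 1 ≤ c * #ties i) (sym (𝟙-yes (P? i) p))
        (≤-trans (+-cancelˡ-≤ (#above i) 1 (#ties i) (begin
          #above i + 1          ≡⟨ +-comm (#above i) 1 ⟩
          suc (#above i)        ≤⟨ <θ ⟩
          θ                     ≤⟨ ≮⇒≥ l≮θ ⟩
          #level i              ≤⟨ #level≤#above+#ties i ⟩
          #above i + #ties i    ∎)) (≤-reflexive (sym (+-identityʳ (#ties i))))))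

lookup-swapAt : (i j : Fin n) (x : Vec (Fin K) n) (u : Fin n) →
                lookup (swapAt i j x) u ≡ lookup x (transpose i j ⟨$⟩ʳ u)
lookup-swapAt i j x u with u Fin.≟ i
lookup-swapAt i j x u | yes refl with u Fin.≟ j
... | yes refl = lookup∘update j (x [ i ]≔ lookup x j) (lookup x i)
... | no u≢j   = trans (lookup∘update′ u≢j (x [ i ]≔ lookup x j) (lookup x i)) (lookup∘update i x (lookup x j))
lookup-swapAt i j x u | no u≢i with u Fin.≟ j
... | yes refl = lookup∘update j (x [ i ]≔ lookup x j) (lookup x i)
... | no u≢j   = trans (lookup∘update′ u≢j (x [ i ]≔ lookup x j) (lookup x i)) (lookup∘update′ u≢i x (lookup x j))

transpose-left : (i j : Fin n) → transpose i j ⟨$⟩ʳ i ≡ j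
transpose-left i j with i Fin.≟ i
... | yes _   = refl
... | no  i≢i = contradiction refl i≢i

transpose-preserves : {P : Pred (Fin n) 0ℓ} (i j : Fin n) → P i → P j →
                      ∀ u → P u → P (transpose i j ⟨$⟩ʳ u)
transpose-preserves i j Pi Pj u Pu with u Fin.≟ i
... | yes _ = Pj
... | no _ with u Fin.≟ j
...   | yes _ = Pi
...   | no _  = Pu

transpose-reflects : {P : Pred (Fin n) 0ℓ} (i j : Fin n) → P i → P j →
                     ∀ u → P (transpose i j ⟨$⟩ʳ u) → P u
transpose-reflects i j Pi Pj u Pπu with u Fin.≟ i
... | yes refl = Pi
... | no _ with u Fin.≟ j
...   | yes refl = Pj
...   | no _     = Pπu

value : Vec (Fin K) n → Fin n → ℕ
value x u = toℕ (lookup x u)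

flipAt : Fin n → Vec (Fin K) n → Vec (Fin K) n
flipAt v x = updateAt x v opposite

#above-swapAt : {P : Pred (Fin n) 0ℓ} (P? : Decidable P) {v i : Fin n} → P v → P i → (x : Vec (Fin K) n) →
                #above P? (value (swapAt v i x)) v ≡ #above P? (value x) i
#above-swapAt {P = P} P? {v} {i} Pv Pi x = begin
  # (λ u → P? u ×-dec (value x′ v <? value x′ u))
    ≡⟨ #-cong (λ u → P? u ×-dec (value x′ v <? value x′ u)) (λ u → P? (π u) ×-dec (value x i <? value x (π u)))
         (λ u (p , v<u) → transpose-preserves {P = P} v i Pv Pi u p , subst₂ _<_ v↦i (moved u) v<u)
         (λ u (p , i<u) → transpose-reflects {P = P} v i Pv Pi u p , subst₂ _<_ (sym v↦i) (sym (moved u)) i<u) ⟩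
  # (λ u → P? (π u) ×-dec (value x i <? value x (π u)))
    ≡⟨ ∑-permute (λ u → 𝟙 (P? u ×-dec (value x i <? value x u))) (transpose v i) ⟨
  # (λ u → P? u ×-dec (value x i <? value x u)) ∎
  where
  open ≡-Reasoning
  x′ = swapAt v i x
  π = transpose v i ⟨$⟩ʳ_
  moved : ∀ u → value x′ u ≡ value x (π u)
  moved u = cong toℕ (lookup-swapAt v i x u)
  v↦i : value x′ v ≡ value x i
  v↦i = trans (moved v) (cong (value x) (transpose-left v i))

-- Redraw the value at u: exactly one of the K possible values agrees with the value at i.
𝔼-tie : {u i : Fin n} → u ≢ i → K * 𝔼 (λ (x : Vec (Fin K) n) → 𝟙 (value x u ≟ value x i)) ≡ K ^ n
𝔼-tie {n} {K} {u} {i} u≢i = begin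
  K * 𝔼 (λ (x : Vec (Fin K) n) → 𝟙 (value x u ≟ value x i))
    ≡⟨ 𝔼-resample u (λ x → 𝟙 (value x u ≟ value x i)) ⟨
  𝔼 (λ x → sum (λ a → 𝟙 (value (x [ u ]≔ a) u ≟ value (x [ u ]≔ a) i)))
    ≡⟨ 𝔼-cong (λ x → trans (∑-cong (pointwise x)) (#-≡ (lookup x i))) ⟩
  𝔼 {K} {n} (λ _ → 1)
    ≡⟨ trans (𝔼-const {K} {n} 1) (*-identityʳ (K ^ n)) ⟩
  K ^ n ∎
  where
  open ≡-Reasoning
  pointwise : ∀ (x : Vec (Fin K) n) a → 𝟙 (value (x [ u ]≔ a) u ≟ value (x [ u ]≔ a) i) ≡ 𝟙 (a Fin.≟ lookup x i)
  pointwise x a rewrite lookup∘update u x a | lookup∘update′ (u≢i ∘ sym) x a =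
    𝟙-cong (toℕ a ≟ value x i) (a Fin.≟ lookup x i) Fin.toℕ-injective (cong toℕ)

module _ {K : ℕ} {Q : Pred (Fin n) 0ℓ} (Q? : Decidable Q) (v : Fin n) where

  #heavy : Vec (Fin K) n → ℕ
  #heavy x = # (λ u → Q? u ×-dec (K ≤? value x u + value x v))

  module _ (¬Qv : ¬ Q v) where

    private
      P? : Decidable (λ u → u ≡ v ⊎ Q u)
      P? u = (u Fin.≟ v) ⊎-dec Q? u

      #P≡1+#Q : # P? ≡ suc (# Q?)
      #P≡1+#Q = begin
        # P?                                      ≡⟨ ∑-cong pointwise ⟩
        sum (λ u → 𝟙 (u Fin.≟ v) + 𝟙 (Q? u))      ≡⟨ ∑-distrib-+ (λ u → 𝟙 (u Fin.≟ v)) (λ u → 𝟙 (Q? u)) ⟩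
        # (Fin._≟ v) + # Q?                       ≡⟨ cong (_+ # Q?) (#-≡ v) ⟩
        suc (# Q?)                                ∎
        where
        open ≡-Reasoning
        pointwise : ∀ u → 𝟙 (P? u) ≡ 𝟙 (u Fin.≟ v) + 𝟙 (Q? u)
        pointwise u with u Fin.≟ v | Q? u
        ... | yes refl | yes Qv = contradiction Qv ¬Qv
        ... | yes _    | no _   = refl
        ... | no _     | yes _  = refl
        ... | no _     | no _   = refl

    -- The reflected value is K - 1 - x_v, and K ≤ x_u + (K - 1 - x_v) says exactly x_v < x_u.
    -- Adding v itself to the neighbourhood is harmless, since v is not strictly above itself.
    #heavy-flipAt : ∀ x → #heavy (flipAt v x) ≡ #above P? (value x) v
    #heavy-flipAt x = #-cong (λ u → Q? u ×-dec (K ≤? value x′ u + value x′ v)) (λ u → P? u ×-dec (value x v <? value x u)) to from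
      where
      x′ = flipAt v x
      flipped : value x′ v + suc (value x v) ≡ K
      flipped = trans (cong (λ a → toℕ a + suc (value x v)) (lookup∘updateAt v x))
        (trans (cong (_+ suc (value x v)) (Fin.opposite-prop (lookup x v))) (m∸n+n≡m (Fin.toℕ<n (lookup x v))))
      unmoved : ∀ {u} → u ≢ v → value x′ u ≡ value x u
      unmoved u≢v = cong toℕ (lookup∘updateAt′ _ v u≢v x)
      to : ∀ u → Q u × K ≤ value x′ u + value x′ v → (u ≡ v ⊎ Q u) × value x v < value x u
      to u (Qu , K≤) with u Fin.≟ v
      ... | yes refl = contradiction Qu ¬Qv
      ... | no u≢v = inj₂ Qu , +-cancelˡ-≤ (value x′ v) _ _ (begin
        value x′ v + suc (value x v)   ≡⟨ flipped ⟩
        K                              ≤⟨ K≤ ⟩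
        value x′ u + value x′ v        ≡⟨ cong (_+ value x′ v) (unmoved u≢v) ⟩
        value x u + value x′ v         ≡⟨ +-comm (value x u) (value x′ v) ⟩
        value x′ v + value x u         ∎)
        where open ≤-Reasoning
      from : ∀ u → (u ≡ v ⊎ Q u) × value x v < value x u → Q u × K ≤ value x′ u + value x′ v
      from u (inj₁ refl , v<v) = contradiction v<v (<-irrefl refl)
      from u (inj₂ Qu , v<u) = Qu , (begin
        K                              ≡⟨ flipped ⟨
        value x′ v + suc (value x v)   ≤⟨ +-monoʳ-≤ (value x′ v) v<u ⟩
        value x′ v + value x u         ≡⟨ +-comm (value x′ v) (value x u) ⟩
        value x u + value x′ v         ≡⟨ cong (_+ value x′ v) (unmoved (λ { refl → ¬Qv Qu })) ⟨
        value x′ u + value x′ v        ∎)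
        where open ≤-Reasoning

    -- After reflecting the value at v, the number of heavy edges at v is the rank of v in its
    -- closed neighbourhood, and all vertices of that neighbourhood are exchangeable.
    𝔼-#heavy< : ∀ θ → suc (# Q?) * 𝔼 (λ x → 𝟙 (#heavy x <? θ)) ≡
                      𝔼 (λ x → # (λ i → P? i ×-dec (#above P? (value x) i <? θ)))
    𝔼-#heavy< θ = begin
      suc (# Q?) * 𝔼 (λ x → 𝟙 (#heavy x <? θ))     ≡⟨ cong (_* 𝔼 (λ x → 𝟙 (#heavy x <? θ))) (sym #P≡1+#Q) ⟩
      # P? * 𝔼 (λ x → 𝟙 (#heavy x <? θ))           ≡⟨ *-distribʳ-sum (𝔼 (λ x → 𝟙 (#heavy x <? θ))) (λ i → 𝟙 (P? i)) ⟩
      sum (λ i → 𝟙 (P? i) * 𝔼 (λ x → 𝟙 (#heavy x <? θ)))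
                                                   ≡⟨ ∑-cong exchange ⟩
      sum (λ i → 𝟙 (P? i) * 𝔼 (λ x → 𝟙 (#above P? (value x) i <? θ)))
                                                   ≡⟨ ∑-cong (λ i → 𝔼-* (𝟙 (P? i)) (λ x → 𝟙 (#above P? (value x) i <? θ))) ⟨
      sum (λ i → 𝔼 (λ x → 𝟙 (P? i) * 𝟙 (#above P? (value x) i <? θ)))
                                                   ≡⟨ 𝔼-∑ (λ i x → 𝟙 (P? i) * 𝟙 (#above P? (value x) i <? θ)) ⟨
      𝔼 (λ x → sum (λ i → 𝟙 (P? i) * 𝟙 (#above P? (value x) i <? θ)))
                                                   ≡⟨ 𝔼-cong (λ x → ∑-cong (λ i → 𝟙-× (P? i) (#above P? (value x) i <? θ))) ⟨
      𝔼 (λ x → # (λ i → P? i ×-dec (#above P? (value x) i <? θ))) ∎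
      where
      open ≡-Reasoning
      exchange : ∀ i → 𝟙 (P? i) * 𝔼 (λ x → 𝟙 (#heavy x <? θ)) ≡
                       𝟙 (P? i) * 𝔼 (λ x → 𝟙 (#above P? (value x) i <? θ))
      exchange i with P? i
      ... | no _   = refl
      ... | yes Pi = cong (1 *_) (begin
        𝔼 (λ x → 𝟙 (#heavy x <? θ))
          ≡⟨ 𝔼-permuteAt reverse v (λ x → 𝟙 (#heavy x <? θ)) ⟨
        𝔼 (λ x → 𝟙 (#heavy (flipAt v x) <? θ))
          ≡⟨ 𝔼-cong (λ x → cong (λ c → 𝟙 (c <? θ)) (#heavy-flipAt x)) ⟩
        𝔼 (λ x → 𝟙 (#above P? (value x) v <? θ))
          ≡⟨ 𝔼-swapAt v i (λ x → 𝟙 (#above P? (value x) v <? θ)) ⟨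
        𝔼 (λ x → 𝟙 (#above P? (value (swapAt v i x)) v <? θ))
          ≡⟨ 𝔼-cong (λ x → cong (λ c → 𝟙 (c <? θ)) (#above-swapAt P? (inj₁ refl) Pi x)) ⟩
        𝔼 (λ x → 𝟙 (#above P? (value x) i <? θ)) ∎)

    𝔼-#heavy<-lower : ∀ {θ} → θ ≤ suc (# Q?) → K ^ n * θ ≤ suc (# Q?) * 𝔼 (λ x → 𝟙 (#heavy x <? θ))
    𝔼-#heavy<-lower {θ} θ≤ = begin
      K ^ n * θ                ≡⟨ 𝔼-const {K} {n} θ ⟨
      𝔼 {K} {n} (λ _ → θ)      ≤⟨ 𝔼-mono (λ x → #-#above<-lower P? (value x) (≤-trans θ≤ (≤-reflexive (sym #P≡1+#Q)))) ⟩
      𝔼 (λ x → # (λ i → P? i ×-dec (#above P? (value x) i <? θ)))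
                               ≡⟨ 𝔼-#heavy< θ ⟨
      suc (# Q?) * 𝔼 (λ x → 𝟙 (#heavy x <? θ)) ∎
      where open ≤-Reasoning

    𝔼-#ties : ∀ i → K * 𝔼 (λ (x : Vec (Fin K) n) → #ties P? (value x) i) ≤ K ^ n * suc (# Q?)
    𝔼-#ties i = begin
      K * 𝔼 (λ (x : Vec (Fin K) n) → #ties P? (value x) i)
        ≡⟨ cong (K *_) (𝔼-∑ (λ u x → tie u x)) ⟩
      K * sum (λ u → 𝔼 (tie u))                            ≡⟨ *-distribˡ-sum K (λ u → 𝔼 (tie u)) ⟩
      sum (λ u → K * 𝔼 (tie u))                            ≤⟨ ∑-mono bound ⟩
      sum (λ u → K ^ n * 𝟙 (P? u))                         ≡⟨ *-distribˡ-sum (K ^ n) (λ u → 𝟙 (P? u)) ⟨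
      K ^ n * # P?                                         ≡⟨ cong (K ^ n *_) #P≡1+#Q ⟩
      K ^ n * suc (# Q?)                                   ∎
      where
      open ≤-Reasoning
      tie : Fin n → Vec (Fin K) n → ℕ
      tie u x = 𝟙 (P? u ×-dec (value x u ≟ value x i) ×-dec ¬? (u Fin.≟ i))
      tie≤ : ∀ u → u ≢ i → ∀ x → tie u x ≤ 𝟙 (P? u) * 𝟙 (value x u ≟ value x i)
      tie≤ u u≢i x = ≤-trans
        (𝟙-mono (P? u ×-dec (value x u ≟ value x i) ×-dec ¬? (u Fin.≟ i)) (P? u ×-dec (value x u ≟ value x i))
          (λ (p , eq , _) → p , eq))
        (≤-reflexive (𝟙-× (P? u) (value x u ≟ value x i)))
      bound : ∀ u → K * 𝔼 (tie u) ≤ K ^ n * 𝟙 (P? u)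
      bound u = bound′ u (u Fin.≟ i)
        where
        bound′ : ∀ u → Dec (u ≡ i) → K * 𝔼 (tie u) ≤ K ^ n * 𝟙 (P? u)
        bound′ u (yes refl) = ≤-trans (≤-reflexive (begin-equality
          K * 𝔼 (tie i)                ≡⟨ cong (K *_) (𝔼-cong (λ x → 𝟙-no (P? i ×-dec (value x i ≟ value x i) ×-dec ¬? (i Fin.≟ i)) (λ (_ , _ , i≢i) → i≢i refl))) ⟩
          K * 𝔼 {K} {n} (λ _ → 0)      ≡⟨ cong (K *_) (trans (𝔼-const {K} {n} 0) (*-zeroʳ (K ^ n))) ⟩
          K * 0                        ≡⟨ *-zeroʳ K ⟩
          0                            ∎)) z≤n
        bound′ u (no u≢i) = begin
          K * 𝔼 (tie u)                ≤⟨ *-monoʳ-≤ K (𝔼-mono (tie≤ u u≢i)) ⟩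
          K * 𝔼 (λ (x : Vec (Fin K) n) → 𝟙 (P? u) * 𝟙 (value x u ≟ value x i))
                                       ≡⟨ cong (K *_) (𝔼-* (𝟙 (P? u)) (λ (x : Vec (Fin K) n) → 𝟙 (value x u ≟ value x i))) ⟩
          K * (𝟙 (P? u) * 𝔼 (λ (x : Vec (Fin K) n) → 𝟙 (value x u ≟ value x i)))
                                       ≡⟨ x∙yz≈xz∙y K (𝟙 (P? u)) (𝔼 (λ (x : Vec (Fin K) n) → 𝟙 (value x u ≟ value x i))) ⟩
          K * 𝔼 (λ (x : Vec (Fin K) n) → 𝟙 (value x u ≟ value x i)) * 𝟙 (P? u)
                                       ≡⟨ cong (_* 𝟙 (P? u)) (𝔼-tie u≢i) ⟩
          K ^ n * 𝟙 (P? u)             ∎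

    -- The error term counts ties: there are at most (1 + `# Q?`)² ordered pairs in the closed
    -- neighbourhood, each tied with probability 1 / K.
    𝔼-#heavy<-upper : ∀ θ → K * (suc (# Q?) * 𝔼 (λ x → 𝟙 (#heavy x <? θ))) ≤
                            K * (K ^ n * θ) + K ^ n * (suc (# Q?) * suc (# Q?))
    𝔼-#heavy<-upper θ = begin
      K * (suc (# Q?) * 𝔼 (λ x → 𝟙 (#heavy x <? θ)))
        ≡⟨ cong (K *_) (𝔼-#heavy< θ) ⟩
      K * 𝔼 (λ x → # (λ i → P? i ×-dec (#above P? (value x) i <? θ)))
        ≤⟨ *-monoʳ-≤ K (𝔼-mono (λ x → #-#above<-upper P? (value x) θ)) ⟩
      K * 𝔼 (λ (x : Vec (Fin K) n) → θ + τ x)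
        ≡⟨ cong (K *_) (trans (𝔼-+ (λ _ → θ) τ) (cong (_+ 𝔼 τ) (𝔼-const {K} {n} θ))) ⟩
      K * (K ^ n * θ + 𝔼 τ)
        ≡⟨ *-distribˡ-+ K (K ^ n * θ) (𝔼 τ) ⟩
      K * (K ^ n * θ) + K * 𝔼 τ
        ≤⟨ +-monoʳ-≤ (K * (K ^ n * θ)) ties ⟩
      K * (K ^ n * θ) + K ^ n * (suc (# Q?) * suc (# Q?)) ∎
      where
      open ≤-Reasoning
      t : Fin n → Vec (Fin K) n → ℕ
      t i x = #ties P? (value x) i
      τ : Vec (Fin K) n → ℕ
      τ x = sum (λ i → 𝟙 (P? i) * t i x)
      ties : K * 𝔼 τ ≤ K ^ n * (suc (# Q?) * suc (# Q?))
      ties = begin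
        K * 𝔼 τ                                          ≡⟨ cong (K *_) (trans (𝔼-∑ (λ i x → 𝟙 (P? i) * t i x)) (∑-cong (λ i → 𝔼-* (𝟙 (P? i)) (t i)))) ⟩
        K * sum (λ i → 𝟙 (P? i) * 𝔼 (t i))               ≡⟨ *-distribˡ-sum K (λ i → 𝟙 (P? i) * 𝔼 (t i)) ⟩
        sum (λ i → K * (𝟙 (P? i) * 𝔼 (t i)))             ≡⟨ ∑-cong (λ i → x∙yz≈y∙xz K (𝟙 (P? i)) (𝔼 (t i))) ⟩
        sum (λ i → 𝟙 (P? i) * (K * 𝔼 (t i)))             ≤⟨ ∑-mono (λ i → *-monoʳ-≤ (𝟙 (P? i)) (𝔼-#ties i)) ⟩
        sum (λ i → 𝟙 (P? i) * (K ^ n * suc (# Q?)))      ≡⟨ *-distribʳ-sum (K ^ n * suc (# Q?)) (λ i → 𝟙 (P? i)) ⟨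
        # P? * (K ^ n * suc (# Q?))                      ≡⟨ cong (_* (K ^ n * suc (# Q?))) #P≡1+#Q ⟩
        suc (# Q?) * (K ^ n * suc (# Q?))                ≡⟨ x∙yz≈y∙xz (suc (# Q?)) (K ^ n) (suc (# Q?)) ⟩
        K ^ n * (suc (# Q?) * suc (# Q?))                ∎

-- Labelings from edge labels and classes

adjacent? : (G : Graph n) (u v : Fin n) → Dec (T (adj G u v))
adjacent? G u v = T? (adj G u v)

module _ {B : Set} {P : Pred B 0ℓ} (P? : Decidable P) (φ : B → ℕ) where

  contribution : Maybe B → ℕ
  contribution nothing  = 0
  contribution (just b) = 𝟙 (P? b) * φ b

  -- Degrees and weights are list sums over `incidentEdges`. Moving the filter and the partial map
  -- into the summand turns them into sums over all ordered pairs of vertices.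
  sum-filter-mapMaybe : {A : Set} (e : A → Maybe B) (xs : List A) →
    List.sum (map φ (filter P? (mapMaybe e xs))) ≡ List.sum (map (contribution ∘ e) xs)
  sum-filter-mapMaybe e []       = refl
  sum-filter-mapMaybe e (a ∷ as) with e a
  ... | nothing = sum-filter-mapMaybe e as
  ... | just b  with P? b
  ...   | yes _ = cong₂ _+_ (sym (+-identityʳ (φ b))) (sum-filter-mapMaybe e as)
  ...   | no _  = sum-filter-mapMaybe e as

sum-allFin : (f : Fin n → ℕ) → List.sum (map f (allFin n)) ≡ sum f
sum-allFin f = trans (cong List.sum (map-tabulate id f)) (sum-tabulate f)
  where
  sum-tabulate : ∀ {n} (f : Fin n → ℕ) → List.sum (tabulate f) ≡ sum f
  sum-tabulate {zero}  f = refl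
  sum-tabulate {suc n} f = cong (f zero +_) (sum-tabulate (f ∘ suc))

sum-cartesianProduct : {A B : Set} (f : A × B → ℕ) (xs : List A) (ys : List B) →
  List.sum (map f (cartesianProduct xs ys)) ≡ List.sum (map (λ a → List.sum (map (λ b → f (a , b)) ys)) xs)
sum-cartesianProduct f []       ys = refl
sum-cartesianProduct f (a ∷ as) ys = begin
  List.sum (map f (map (a ,_) ys ++ cartesianProduct as ys))
    ≡⟨ cong List.sum (map-++ f (map (a ,_) ys) (cartesianProduct as ys)) ⟩
  List.sum (map f (map (a ,_) ys) ++ map f (cartesianProduct as ys))
    ≡⟨ sum-++ (map f (map (a ,_) ys)) (map f (cartesianProduct as ys)) ⟩
  List.sum (map f (map (a ,_) ys)) + List.sum (map f (cartesianProduct as ys))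
    ≡⟨ cong₂ _+_ (cong List.sum (sym (map-∘ ys))) (sum-cartesianProduct f as ys) ⟩
  List.sum (map (λ b → f (a , b)) ys) + List.sum (map (λ a → List.sum (map (λ b → f (a , b)) ys)) as) ∎
  where open ≡-Reasoning

sum-allPairs : (f : Fin n → Fin n → ℕ) →
  List.sum (map (λ (u , v) → f u v) (cartesianProduct (allFin n) (allFin n))) ≡ sum (λ u → sum (λ v → f u v))
sum-allPairs {n} f = trans (sum-cartesianProduct (λ (u , v) → f u v) (allFin n) (allFin n))
  (trans (sum-allFin (λ u → List.sum (map (f u) (allFin n)))) (∑-cong (λ u → sum-allFin (f u))))

module _ (G : Graph n) (f : Fin n → Fin n → ℕ) (f-sym : ∀ u v → f u v ≡ f v u) where

  private
    edge? : ∀ u v → Dec (u Fin.< v × T (adj G u v))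
    edge? u v = (u Fin.<? v) ×-dec T? (adj G u v)

    term : Fin n → Fin n → ℕ
    term u v = 𝟙 (edge? u v) * f u v

    merge : ∀ x u → term x u + term u x ≡ 𝟙 (adjacent? G x u) * f x u
    merge x u with Fin.<-cmp x u
    ... | tri< x<u _ u≮x = trans
      (cong₂ _+_
        (cong (_* f x u) (𝟙-cong (edge? x u) (adjacent? G x u) proj₂ (x<u ,_)))
        (cong (_* f u x) (𝟙-no (edge? u x) (u≮x ∘ proj₁))))
      (+-identityʳ _)
    ... | tri≈ x≮x refl _ rewrite 𝟙-no (edge? x x) (x≮x ∘ proj₁) | irreflexive G x = refl
    ... | tri> x≮u _ u<x = cong₂ _+_
      (cong (_* f x u) (𝟙-no (edge? x u) (x≮u ∘ proj₁)))
      (cong₂ _*_ (𝟙-cong (edge? u x) (adjacent? G x u)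
                   (λ (_ , a) → subst T (symmetric G u x) a) (λ a → u<x , subst T (symmetric G x u) a))
                 (f-sym u x))

    endpoints : ∀ x u v → 𝟙 (edge? u v) * (𝟙 ((x Fin.≟ u) ⊎-dec (x Fin.≟ v)) * f u v) ≡
                          𝟙 (u Fin.≟ x) * term u v + 𝟙 (v Fin.≟ x) * term u v
    endpoints x u v with edge? u v
    ... | no _ = sym (cong₂ _+_ (*-zeroʳ (𝟙 (u Fin.≟ x))) (*-zeroʳ (𝟙 (v Fin.≟ x))))
    ... | yes (u<v , _) = trans (+-identityʳ _) (trans
      (cong (_* f u v) disjoint)
      (trans (*-distribʳ-+ (f u v) (𝟙 (u Fin.≟ x)) (𝟙 (v Fin.≟ x)))
             (sym (cong₂ _+_ (cong (𝟙 (u Fin.≟ x) *_) (+-identityʳ (f u v))) (cong (𝟙 (v Fin.≟ x) *_) (+-identityʳ (f u v)))))))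
      where
      disjoint : 𝟙 ((x Fin.≟ u) ⊎-dec (x Fin.≟ v)) ≡ 𝟙 (u Fin.≟ x) + 𝟙 (v Fin.≟ x)
      disjoint with u Fin.≟ x | v Fin.≟ x
      ... | yes refl | yes refl = contradiction u<v (Fin.<-irrefl refl)
      ... | yes refl | no _     = 𝟙-yes ((x Fin.≟ u) ⊎-dec (x Fin.≟ v)) (inj₁ refl)
      ... | no _     | yes refl = 𝟙-yes ((x Fin.≟ u) ⊎-dec (x Fin.≟ v)) (inj₂ refl)
      ... | no u≢x   | no v≢x   = 𝟙-no ((x Fin.≟ u) ⊎-dec (x Fin.≟ v)) [ u≢x ∘ sym , v≢x ∘ sym ]′

  -- Edges are stored as increasing pairs, so those at x split into pairs with x first and pairs
  -- with x second. For each neighbour exactly one of the two occurs, and the symmetry of f lets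
  -- both be written as `f x u`.
  sum-incidentEdges : (φ : Edge G → ℕ) → (∀ u v p → φ ((u , v) , p) ≡ f u v) → ∀ x →
    List.sum (map φ (incidentEdges G x)) ≡ sum (λ u → 𝟙 (adjacent? G x u) * f x u)
  sum-incidentEdges φ φ≡f x = begin
    List.sum (map φ (incidentEdges G x))
      ≡⟨ sum-filter-mapMaybe (incident? G x) φ _ (cartesianProduct (allFin n) (allFin n)) ⟩
    List.sum (map _ (cartesianProduct (allFin n) (allFin n)))
      ≡⟨ cong List.sum (map-cong pointwise (cartesianProduct (allFin n) (allFin n))) ⟩
    List.sum (map (λ (u , v) → 𝟙 (edge? u v) * (𝟙 ((x Fin.≟ u) ⊎-dec (x Fin.≟ v)) * f u v)) (cartesianProduct (allFin n) (allFin n)))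
      ≡⟨ sum-allPairs (λ u v → 𝟙 (edge? u v) * (𝟙 ((x Fin.≟ u) ⊎-dec (x Fin.≟ v)) * f u v)) ⟩
    sum (λ u → sum (λ v → 𝟙 (edge? u v) * (𝟙 ((x Fin.≟ u) ⊎-dec (x Fin.≟ v)) * f u v)))
      ≡⟨ ∑-cong (λ u → ∑-cong (endpoints x u)) ⟩
    sum (λ u → sum (λ v → 𝟙 (u Fin.≟ x) * term u v + 𝟙 (v Fin.≟ x) * term u v))
      ≡⟨ ∑-∑-+ (λ u v → 𝟙 (u Fin.≟ x) * term u v) (λ u v → 𝟙 (v Fin.≟ x) * term u v) ⟩
    sum (λ u → sum (λ v → 𝟙 (u Fin.≟ x) * term u v)) + sum (λ u → sum (λ v → 𝟙 (v Fin.≟ x) * term u v))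
      ≡⟨ cong₂ _+_
           (trans (∑-cong (λ u → sym (*-distribˡ-sum (𝟙 (u Fin.≟ x)) (term u)))) (∑-𝟙≡ (λ u → sum (term u)) x))
           (∑-cong (λ u → ∑-𝟙≡ (term u) x)) ⟩
    sum (term x) + sum (λ u → term u x)
      ≡⟨ ∑-distrib-+ (term x) (λ u → term u x) ⟨
    sum (λ u → term x u + term u x)
      ≡⟨ ∑-cong (merge x) ⟩
    sum (λ u → 𝟙 (adjacent? G x u) * f x u) ∎
    where
    open ≡-Reasoning
    pointwise : ∀ ((u , v) : Fin n × Fin n) →
                contribution (incident? G x) φ (Maybe.map ((u , v) ,_) (dec⇒maybe (edge? u v))) ≡
                𝟙 (edge? u v) * (𝟙 ((x Fin.≟ u) ⊎-dec (x Fin.≟ v)) * f u v)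
    pointwise (u , v) with edge? u v
    ... | yes p = trans (cong (𝟙 ((x Fin.≟ u) ⊎-dec (x Fin.≟ v)) *_) (φ≡f u v p)) (sym (+-identityʳ _))
    ... | no _  = refl

length≡sum : {A : Set} (xs : List A) → length xs ≡ List.sum (map (λ _ → 1) xs)
length≡sum []       = refl
length≡sum (_ ∷ xs) = cong suc (length≡sum xs)

degree≡# : (G : Graph n) (v : Fin n) → degree G v ≡ # (adjacent? G v)
degree≡# G v = trans (length≡sum (incidentEdges G v))
  (trans (sum-incidentEdges G (λ _ _ → 1) (λ _ _ → refl) (λ _ → 1) (λ _ _ _ → refl) v)
         (∑-cong (λ u → *-identityʳ (𝟙 (adjacent? G v u)))))

edgeSum : Graph n → (Fin n → Fin n → ℕ) → Fin n → ℕ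
edgeSum G f v = sum (λ u → 𝟙 (adjacent? G v u) * f v u)

module _ {d s : ℕ} (G : Graph n) (regular : Regular d G)
         (f : Fin n → Fin n → ℕ) (f-sym : ∀ u v → f u v ≡ f v u) (f≤s : ∀ u v → f u v ≤ s) where

  -- The vertex label makes up the difference between the edge sum and the prescribed weight.
  -- Raising all labels from 0, ..., s to 1, ..., s + 1 adds d + 1 to every weight, by regularity,
  -- so distinctness survives.
  labeling-from-weights : (w : Fin n → ℕ) → (∀ u v → u ≢ v → w u ≢ w v) →
    (∀ v → edgeSum G f v ≤ w v) → (∀ v → w v ≤ edgeSum G f v + s) → HasIrregularLabeling G (suc s)
  labeling-from-weights w w-distinct lower upper = ℓ , λ u v u≢v eq →
    w-distinct u v u≢v (suc-injective (+-cancelʳ-≡ d _ _ (trans (sym (weight≡ u)) (trans eq (weight≡ v)))))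
    where
    ℓ : TotalLabeling G (suc s)
    label ℓ (inj₁ v)             = suc (w v ∸ edgeSum G f v)
    label ℓ (inj₂ ((u , v) , _)) = suc (f u v)
    label-pos ℓ (inj₁ _) = s≤s z≤n
    label-pos ℓ (inj₂ _) = s≤s z≤n
    label-≤ ℓ (inj₁ v) = s≤s (m≤n+o⇒m∸n≤o (w v) (edgeSum G f v) (upper v))
    label-≤ ℓ (inj₂ ((u , v) , _)) = s≤s (f≤s u v)
    weight≡ : ∀ v → weight ℓ v ≡ suc (w v) + d
    weight≡ v = cong suc (begin
      w v ∸ edgeSum G f v + List.sum (map (λ e → label ℓ (inj₂ e)) (incidentEdges G v))
        ≡⟨ cong (w v ∸ edgeSum G f v +_) (sum-incidentEdges G (λ a b → suc (f a b)) (λ a b → cong suc (f-sym a b)) _ (λ _ _ _ → refl) v) ⟩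
      w v ∸ edgeSum G f v + sum (λ u → 𝟙 (adjacent? G v u) * suc (f v u))
        ≡⟨ cong (w v ∸ edgeSum G f v +_) (∑-cong (λ u → *-suc (𝟙 (adjacent? G v u)) (f v u))) ⟩
      w v ∸ edgeSum G f v + sum (λ u → 𝟙 (adjacent? G v u) + 𝟙 (adjacent? G v u) * f v u)
        ≡⟨ cong (w v ∸ edgeSum G f v +_) (∑-distrib-+ (λ u → 𝟙 (adjacent? G v u)) (λ u → 𝟙 (adjacent? G v u) * f v u)) ⟩
      w v ∸ edgeSum G f v + (# (adjacent? G v) + edgeSum G f v)
        ≡⟨ cong (λ e → w v ∸ edgeSum G f v + (e + edgeSum G f v)) (trans (sym (degree≡# G v)) (regular v)) ⟩
      w v ∸ edgeSum G f v + (d + edgeSum G f v)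
        ≡⟨ +ₚ.x∙yz≈xz∙y (w v ∸ edgeSum G f v) d (edgeSum G f v) ⟩
      w v ∸ edgeSum G f v + edgeSum G f v + d
        ≡⟨ cong (_+ d) (m∸n+n≡m (lower v)) ⟩
      w v + d ∎)
      where
      open ≡-Reasoning

  -- Vertices are sorted by κ, with ties broken by vertex number, and the weight is the number of
  -- predecessors. The tie-break makes weights distinct and confines each to the block of its class.
  labeling-from-classes : (κ : Fin n → ℕ) →
    (∀ v → edgeSum G f v ≤ # (λ u → κ u <? κ v)) →
    (∀ v → # (λ u → κ u <? suc (κ v)) ≤ edgeSum G f v + suc s) → HasIrregularLabeling G (suc s)
  labeling-from-classes κ lower upper = labeling-from-weights position distinct
    (λ v → ≤-trans (lower v) (#-mono (λ u → κ u <? κ v) (λ u → before? u v) (λ _ → inj₁)))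
    -- The vertex v lies in its own class but does not precede itself; this strictness turns the
    -- bound with `suc s` into one with s.
    (λ v → s≤s⁻¹ (≤-trans (#-mono-< (λ u → before? u v) (λ u → κ u <? suc (κ v)) v before-irrefl ≤-refl (λ _ → before⇒≤))
                    (≤-trans (upper v) (≤-reflexive (+-suc _ s)))))
    where
    Before : Fin n → Fin n → Set
    Before u v = κ u < κ v ⊎ (κ u ≡ κ v × u Fin.< v)
    before? : ∀ u v → Dec (Before u v)
    before? u v = (κ u <? κ v) ⊎-dec ((κ u ≟ κ v) ×-dec (u Fin.<? v))
    position : Fin n → ℕ
    position v = # (λ u → before? u v)
    before-irrefl : ∀ {v} → ¬ Before v v
    before-irrefl (inj₁ <κ)        = <-irrefl refl <κ
    before-irrefl (inj₂ (_ , v<v)) = Fin.<-irrefl refl v<v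
    before-trans : ∀ {u v w} → Before u v → Before v w → Before u w
    before-trans (inj₁ p)         (inj₁ q)          = inj₁ (<-trans p q)
    before-trans {u} (inj₁ p)     (inj₂ (eq , _))   = inj₁ (subst (κ u <_) eq p)
    before-trans {w = w} (inj₂ (eq , _)) (inj₁ q)   = inj₁ (subst (_< κ w) (sym eq) q)
    before-trans (inj₂ (eq , p))  (inj₂ (eq′ , q))  = inj₂ (trans eq eq′ , <-trans p q)
    before⇒≤ : ∀ {u v} → Before u v → κ u < suc (κ v)
    before⇒≤ (inj₁ <κ)       = m<n⇒m<1+n <κ
    before⇒≤ (inj₂ (eq , _)) = s≤s (≤-reflexive eq)
    position-mono : ∀ {u v} → Before u v → position u < position v
    position-mono {u} {v} u<v = #-mono-< (λ z → before? z u) (λ z → before? z v) u before-irrefl u<v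
      (λ _ z<u → before-trans z<u u<v)
    distinct : ∀ u v → u ≢ v → position u ≢ position v
    distinct u v u≢v eq with <-cmp (κ u) (κ v)
    ... | tri< κu<κv _ _ = <-irrefl eq (position-mono (inj₁ κu<κv))
    ... | tri> _ _ κv<κu = <-irrefl (sym eq) (position-mono (inj₁ κv<κu))
    ... | tri≈ _ κu≡κv _ with Fin.<-cmp u v
    ...   | tri< u<v _ _ = <-irrefl eq (position-mono (inj₂ (κu≡κv , u<v)))
    ...   | tri≈ _ u≡v _ = u≢v u≡v
    ...   | tri> _ _ v<u = <-irrefl (sym eq) (position-mono (inj₂ (sym κu≡κv , v<u)))

-- The lower bound by counting weights

sum-map-bounds : {A : Set} {k : ℕ} (g : A → ℕ) → (∀ a → 1 ≤ g a) → (∀ a → g a ≤ k) → ∀ xs →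
                 length xs ≤ List.sum (map g xs) × List.sum (map g xs) ≤ length xs * k
sum-map-bounds g 1≤g g≤k []       = z≤n , z≤n
sum-map-bounds g 1≤g g≤k (a ∷ as) with lo , hi ← sum-map-bounds g 1≤g g≤k as =
  +-mono-≤ (1≤g a) lo , +-mono-≤ (g≤k a) hi

-- Weights lie between d + 1 and (d + 1) k, which leaves (d + 1) k - d values for n distinct
-- weights.
labeling-bound : ∀ {d k} (G : Graph n) → Regular d G → 1 ≤ k → HasIrregularLabeling G k → n + d ≤ suc d * k
labeling-bound {n} {d} {k} G regular 1≤k (ℓ , irregular) = begin
  n + d                    ≤⟨ +-monoˡ-≤ d (Fin.injective⇒≤ {f = index} index-injective) ⟩
  (suc d * k ∸ d) + d      ≡⟨ m∸n+n≡m d≤ ⟩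
  suc d * k                ∎
  where
  open ≤-Reasoning
  d≤ : d ≤ suc d * k
  d≤ = ≤-trans (n≤1+n d) (m≤m*n (suc d) k {{>-nonZero 1≤k}})
  edgeBounds : ∀ v → d ≤ List.sum (map (λ e → label ℓ (inj₂ e)) (incidentEdges G v)) ×
                     List.sum (map (λ e → label ℓ (inj₂ e)) (incidentEdges G v)) ≤ d * k
  edgeBounds v = subst (λ δ → δ ≤ S × S ≤ δ * k) (regular v)
    (sum-map-bounds (λ e → label ℓ (inj₂ e)) (label-pos ℓ ∘ inj₂) (label-≤ ℓ ∘ inj₂) (incidentEdges G v))
    where S = List.sum (map (λ e → label ℓ (inj₂ e)) (incidentEdges G v))
  lower : ∀ v → suc d ≤ weight ℓ v
  lower v = +-mono-≤ (label-pos ℓ (inj₁ v)) (proj₁ (edgeBounds v))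
  upper : ∀ v → weight ℓ v ≤ suc d * k
  upper v = +-mono-≤ (label-≤ ℓ (inj₁ v)) (proj₂ (edgeBounds v))
  index< : ∀ v → weight ℓ v ∸ suc d < suc d * k ∸ d
  index< v = begin-strict
    weight ℓ v ∸ suc d     ≤⟨ ∸-monoˡ-≤ (suc d) (upper v) ⟩
    suc d * k ∸ suc d      <⟨ ∸-monoʳ-< (n<1+n d) (≤-trans (lower v) (upper v)) ⟩
    suc d * k ∸ d          ∎
  index : Fin n → Fin (suc d * k ∸ d)
  index v = fromℕ< (index< v)
  index-injective : ∀ {u v} → index u ≡ index v → u ≡ v
  index-injective {u} {v} eq with u Fin.≟ v
  ... | yes u≡v = u≡v
  ... | no u≢v  = contradiction
    (∸-cancelʳ-≡ (lower u) (lower v) (Fin.fromℕ<-injective _ _ (index< u) (index< v) eq)) (irregular u v u≢v)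

-- Matchings

∑<n⇒zero : (f : Fin n → ℕ) → sum f < n → ∃ λ i → f i ≡ 0
∑<n⇒zero {suc n} f ∑< with f zero in eq
... | zero  = zero , eq
... | suc k with i , fi≡0 ← ∑<n⇒zero (f ∘ suc) (≤-<-trans (m≤n+m _ k) (s<s⁻¹ ∑<)) = suc i , fi≡0

-- A matching is encoded by the involution exchanging matched vertices and fixing the others.
record Matching (G : Graph n) (m : ℕ) : Set where
  field
    mate       : Fin n → Fin n
    involutive : ∀ v → mate (mate v) ≡ v
  -- By irreflexivity a fixed point of `mate` is never matched, so together with `support` this is
  -- equivalent to `mate v ≢ v`. As an adjacency it sums directly against neighbourhoods.
  Matched : Fin n → Set
  Matched v = T (adj G v (mate v))
  matched? : Decidable Matched
  matched? v = adjacent? G v (mate v)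
  field
    support    : ∀ v → mate v ≢ v → Matched v
    size       : # matched? ≡ 2 * m

irreflexive-T : (G : Graph n) → ∀ {v} → ¬ T (adj G v v)
irreflexive-T G {v} = subst T (irreflexive G v)

symmetric-T : (G : Graph n) → ∀ {u v} → T (adj G u v) → T (adj G v u)
symmetric-T G {u} {v} = subst T (symmetric G u v)

module _ {G : Graph n} where
  open Matching

  empty : Matching G 0
  mate       empty v = v
  involutive empty v = refl
  support    empty v v≢v = contradiction refl v≢v
  size       empty = trans (∑-cong (λ v → 𝟙-no (adjacent? G v v) (irreflexive-T G))) (trans (∑-const n 0) (*-zeroʳ n))

  module _ {m} (M : Matching G m) {a c : Fin n} (a~c : T (adj G a c)) (¬Ma : ¬ Matched M a) (¬Mc : ¬ Matched M c) where

    private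
      mate′ : Fin n → Fin n
      mate′ v with v Fin.≟ a | v Fin.≟ c
      ... | yes _ | _     = c
      ... | no _  | yes _ = a
      ... | no _  | no _  = mate M v

      a≢c : a ≢ c
      a≢c refl = irreflexive-T G a~c

      fixed : ∀ {v} → ¬ Matched M v → mate M v ≡ v
      fixed {v} ¬Mv with mate M v Fin.≟ v
      ... | yes eq = eq
      ... | no neq = contradiction (support M v neq) ¬Mv

      at-a : mate′ a ≡ c
      at-a with a Fin.≟ a | a Fin.≟ c
      ... | yes _  | _ = refl
      ... | no a≢a | _ = contradiction refl a≢a

      at-c : mate′ c ≡ a
      at-c with c Fin.≟ a | c Fin.≟ c
      ... | yes c≡a | _      = contradiction (sym c≡a) a≢c
      ... | no _    | yes _  = refl
      ... | no _    | no c≢c = contradiction refl c≢c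

      elsewhere : ∀ {v} → v ≢ a → v ≢ c → mate′ v ≡ mate M v
      elsewhere {v} v≢a v≢c with v Fin.≟ a | v Fin.≟ c
      ... | yes v≡a | _       = contradiction v≡a v≢a
      ... | no _    | yes v≡c = contradiction v≡c v≢c
      ... | no _    | no _    = refl

      mate-avoids : ∀ {v w} → ¬ Matched M w → v ≢ w → mate M v ≢ w
      mate-avoids {v} ¬Mw v≢w eq = v≢w (trans (sym (involutive M v)) (trans (cong (mate M) eq) (fixed ¬Mw)))

      involutive′ : ∀ v → mate′ (mate′ v) ≡ v
      involutive′ v = by-cases (v Fin.≟ a) (v Fin.≟ c)
        where
        by-cases : Dec (v ≡ a) → Dec (v ≡ c) → mate′ (mate′ v) ≡ v
        by-cases (yes refl) _          = trans (cong mate′ at-a) at-c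
        by-cases (no _)     (yes refl) = trans (cong mate′ at-c) at-a
        by-cases (no v≢a)   (no v≢c)   = trans (cong mate′ (elsewhere v≢a v≢c))
          (trans (elsewhere (mate-avoids ¬Ma v≢a) (mate-avoids ¬Mc v≢c)) (involutive M v))

      support′ : ∀ v → mate′ v ≢ v → T (adj G v (mate′ v))
      support′ v = by-cases (v Fin.≟ a) (v Fin.≟ c)
        where
        by-cases : Dec (v ≡ a) → Dec (v ≡ c) → mate′ v ≢ v → T (adj G v (mate′ v))
        by-cases (yes refl) _          _ = subst (T ∘ adj G a) (sym at-a) a~c
        by-cases (no _)     (yes refl) _ = subst (T ∘ adj G c) (sym at-c) (symmetric-T G a~c)
        by-cases (no v≢a)   (no v≢c)     = subst (λ w → w ≢ v → T (adj G v w)) (sym (elsewhere v≢a v≢c)) (support M v)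

      indicator : ∀ v → 𝟙 (adjacent? G v (mate′ v)) ≡ 𝟙 (v Fin.≟ a) + (𝟙 (v Fin.≟ c) + 𝟙 (matched? M v))
      indicator v with v Fin.≟ a | v Fin.≟ c
      ... | yes refl | yes refl = contradiction refl a≢c
      ... | yes refl | no _     = trans (𝟙-yes (adjacent? G a c) a~c) (sym (cong suc (𝟙-no (matched? M a) ¬Ma)))
      ... | no _     | yes refl = trans (𝟙-yes (adjacent? G c a) (symmetric-T G a~c)) (sym (cong suc (𝟙-no (matched? M c) ¬Mc)))
      ... | no _     | no _     = refl

    extend : Matching G (suc m)
    mate       extend = mate′
    involutive extend = involutive′
    support    extend = support′
    size       extend = begin
      sum (λ v → 𝟙 (adjacent? G v (mate′ v)))                              ≡⟨ ∑-cong indicator ⟩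
      sum (λ v → 𝟙 (v Fin.≟ a) + (𝟙 (v Fin.≟ c) + 𝟙 (matched? M v)))       ≡⟨ ∑-distrib-+ (λ v → 𝟙 (v Fin.≟ a)) (λ v → 𝟙 (v Fin.≟ c) + 𝟙 (matched? M v)) ⟩
      # (Fin._≟ a) + sum (λ v → 𝟙 (v Fin.≟ c) + 𝟙 (matched? M v))          ≡⟨ cong₂ _+_ (#-≡ a) (∑-distrib-+ (λ v → 𝟙 (v Fin.≟ c)) (λ v → 𝟙 (matched? M v))) ⟩
      1 + (# (Fin._≟ c) + # (matched? M))                                  ≡⟨ cong₂ (λ p q → 1 + (p + q)) (#-≡ c) (size M) ⟩
      2 + 2 * m                                                            ≡⟨ *-suc 2 m ⟨
      2 * suc m                                                            ∎
      where open ≡-Reasoning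

  -- Greedy. With m edges chosen, the 2m matched vertices and their neighbours number at most 2m (d
  -- + 1) < n, so some vertex a is unmatched and has no matched neighbour; any edge at a extends the
  -- matching.
  large-matching : ∀ {d} → 1 ≤ d → Regular d G → ∀ m → 2 * m * suc d ≤ n → Matching G m
  large-matching 1≤d regular zero    _ = empty
  large-matching {d} 1≤d regular (suc m) room = grow
    where
    open ≤-Reasoning
    #adj : ∀ v → # (adjacent? G v) ≡ d
    #adj v = trans (sym (degree≡# G v)) (regular v)
    smaller : 2 * m * suc d < n
    smaller = <-≤-trans (*-monoˡ-< (suc d) (*-monoʳ-< 2 (n<1+n m))) room
    M : Matching G m
    M = large-matching 1≤d regular m (<⇒≤ smaller)
    near : Fin n → ℕ
    near v = sum (λ u → 𝟙 (adjacent? G v u) * 𝟙 (matched? M u))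
    ∑-near : sum near ≡ 2 * m * d
    ∑-near = begin-equality
      sum near                                                             ≡⟨ ∑-comm (λ v u → 𝟙 (adjacent? G v u) * 𝟙 (matched? M u)) ⟩
      sum (λ u → sum (λ v → 𝟙 (adjacent? G v u) * 𝟙 (matched? M u)))       ≡⟨ ∑-cong (λ u → *-distribʳ-sum (𝟙 (matched? M u)) (λ v → 𝟙 (adjacent? G v u))) ⟨
      sum (λ u → sum (λ v → 𝟙 (adjacent? G v u)) * 𝟙 (matched? M u))       ≡⟨ ∑-cong (λ u → cong (_* 𝟙 (matched? M u)) (trans (#-cong (λ v → adjacent? G v u) (adjacent? G u) (λ _ → symmetric-T G) (λ _ → symmetric-T G)) (#adj u))) ⟩
      sum (λ u → d * 𝟙 (matched? M u))                                     ≡⟨ *-distribˡ-sum d (λ u → 𝟙 (matched? M u)) ⟨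
      d * # (matched? M)                                                   ≡⟨ cong (d *_) (size M) ⟩
      d * (2 * m)                                                          ≡⟨ *-comm d (2 * m) ⟩
      2 * m * d                                                            ∎
    ∑< : sum (λ v → 𝟙 (matched? M v) + near v) < n
    ∑< = begin-strict
      sum (λ v → 𝟙 (matched? M v) + near v)     ≡⟨ ∑-distrib-+ (λ v → 𝟙 (matched? M v)) near ⟩
      # (matched? M) + sum near                 ≡⟨ cong₂ _+_ (size M) ∑-near ⟩
      2 * m + 2 * m * d                         ≡⟨ *-suc (2 * m) d ⟨
      2 * m * suc d                             <⟨ smaller ⟩
      n                                         ∎
    unmatched : ∀ {v} → 𝟙 (matched? M v) ≡ 0 → ¬ Matched M v
    unmatched {v} eq Mv = contradiction (trans (sym (𝟙-yes (matched? M v) Mv)) eq) (λ ())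
    grow : Matching G (suc m)
    grow with a , eq ← ∑<n⇒zero (λ v → 𝟙 (matched? M v) + near v) ∑<
         with c , 1≤ ← ∑-positive (λ u → 𝟙 (adjacent? G a u)) (subst (1 ≤_) (sym (#adj a)) 1≤d) =
      extend M a~c (unmatched (m+n≡0⇒m≡0 (𝟙 (matched? M a)) eq)) (unmatched (n≤0⇒n≡0 (begin
        𝟙 (matched? M c)                              ≡⟨ *-identityˡ (𝟙 (matched? M c)) ⟨
        1 * 𝟙 (matched? M c)                          ≡⟨ cong (_* 𝟙 (matched? M c)) (𝟙-yes (adjacent? G a c) a~c) ⟨
        𝟙 (adjacent? G a c) * 𝟙 (matched? M c)        ≤⟨ term≤∑ (λ u → 𝟙 (adjacent? G a u) * 𝟙 (matched? M u)) c ⟩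
        near a                                        ≡⟨ m+n≡0⇒n≡0 (𝟙 (matched? M a)) eq ⟩
        0                                             ∎)))
      where
      a~c : T (adj G a c)
      a~c = 𝟙-positive (adjacent? G a c) 1≤

-- Sampling

module Sampling {G : Graph n} {d m : ℕ} (regular : Regular d G) (M : Matching G m) where

  open Matching M

  Free : Fin n → Fin n → Set
  Free v u = T (adj G v u) × mate v ≢ u

  free? : ∀ v → Decidable (Free v)
  free? v u = adjacent? G v u ×-dec ¬? (mate v Fin.≟ u)

  b : Fin n → ℕ
  b v = 𝟙 (matched? v)

  ∑-mate : ∀ v (f : Fin n → ℕ) → sum (λ u → 𝟙 (mate v Fin.≟ u) * f u) ≡ f (mate v)
  ∑-mate v f = trans
    (∑-cong (λ u → cong (_* f u) (𝟙-cong (mate v Fin.≟ u) (u Fin.≟ mate v) sym sym)))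
    (∑-𝟙≡ f (mate v))

  #free+b : ∀ v → # (free? v) + b v ≡ d
  #free+b v = begin
    # (free? v) + b v
      ≡⟨ cong (# (free? v) +_) (∑-mate v (λ u → 𝟙 (adjacent? G v u))) ⟨
    # (free? v) + sum (λ u → 𝟙 (mate v Fin.≟ u) * 𝟙 (adjacent? G v u))
      ≡⟨ ∑-distrib-+ (λ u → 𝟙 (free? v u)) (λ u → 𝟙 (mate v Fin.≟ u) * 𝟙 (adjacent? G v u)) ⟨
    sum (λ u → 𝟙 (free? v u) + 𝟙 (mate v Fin.≟ u) * 𝟙 (adjacent? G v u))
      ≡⟨ ∑-cong (λ u → split (adjacent? G v u) (mate v Fin.≟ u)) ⟩
    # (adjacent? G v)
      ≡⟨ trans (sym (degree≡# G v)) (regular v) ⟩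
    d ∎
    where
    open ≡-Reasoning
    split : ∀ {P Q : Set} (P? : Dec P) (Q? : Dec Q) → 𝟙 (P? ×-dec ¬? Q?) + 𝟙 Q? * 𝟙 P? ≡ 𝟙 P?
    split (yes _) (yes _) = refl
    split (yes _) (no _)  = refl
    split (no _)  (yes _) = refl
    split (no _)  (no _)  = refl

  -- For b in {0, 1}, (d + b)(d + 1 - b) = (d + 1) d. Hence after scaling by (d + 1) d, the
  -- probability θ / (d + 1 - b) becomes the integer (d + b) θ.
  share : ∀ v → (d + b v) * suc (# (free? v)) ≡ suc d * d
  share v with matched? v | #free+b v
  ... | yes _ | eq = trans (cong ((d + 1) *_) (trans (+-comm 1 (# (free? v))) eq)) (cong (_* d) (+-comm d 1))
  ... | no _  | eq = trans (cong ((d + 0) *_) (cong suc (trans (sym (+-identityʳ (# (free? v)))) eq)))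
                           (trans (cong (_* suc d) (+-identityʳ d)) (*-comm d (suc d)))

  #free≤d : ∀ v → # (free? v) ≤ d
  #free≤d v = ≤-trans (m≤m+n (# (free? v)) (b v)) (≤-reflexive (#free+b v))

  suc-#free : ∀ v → suc (# (free? v)) ≡ suc d ∸ b v
  suc-#free v = trans (sym (m+n∸n≡m (suc (# (free? v))) (b v))) (cong (λ e → suc e ∸ b v) (#free+b v))

  -- For thresholds between 0 and 1 + `# (free? v)`, this is (d + 1) d times the expected number of
  -- vertices whose heavy degree is below θ, with ties ignored.
  target : (Fin n → ℕ) → ℕ
  target θ = sum (λ v → (d + b v) * θ v)

  module _ {K : ℕ} where

    heavyDegree : Vec (Fin K) n → Fin n → ℕ
    heavyDegree x v = #heavy (free? v) v x

    #heavy< : (Fin n → ℕ) → Vec (Fin K) n → ℕ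
    #heavy< θ x = # (λ v → heavyDegree x v <? θ v)

    -- Changing the value at a can affect only the heavy degrees of a and of its d neighbours.
    #heavy<-Lipschitz : ∀ θ → Lipschitz (suc d) (#heavy< θ)
    #heavy<-Lipschitz θ x a t = begin
      #heavy< θ (x [ a ]≔ t)
        ≤⟨ ∑-mono pointwise ⟩
      sum (λ v → 𝟙 (heavyDegree x v <? θ v) + (𝟙 (v Fin.≟ a) + 𝟙 (adjacent? G a v)))
        ≡⟨ ∑-distrib-+ (λ v → 𝟙 (heavyDegree x v <? θ v)) (λ v → 𝟙 (v Fin.≟ a) + 𝟙 (adjacent? G a v)) ⟩
      #heavy< θ x + sum (λ v → 𝟙 (v Fin.≟ a) + 𝟙 (adjacent? G a v))
        ≡⟨ cong (#heavy< θ x +_) (∑-distrib-+ (λ v → 𝟙 (v Fin.≟ a)) (λ v → 𝟙 (adjacent? G a v))) ⟩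
      #heavy< θ x + (# (Fin._≟ a) + # (adjacent? G a))
        ≡⟨ cong (#heavy< θ x +_) (cong₂ _+_ (#-≡ a) (trans (sym (degree≡# G a)) (regular a))) ⟩
      #heavy< θ x + suc d ∎
      where
      open ≤-Reasoning
      unchanged : ∀ v → v ≢ a → ¬ T (adj G a v) → heavyDegree (x [ a ]≔ t) v ≡ heavyDegree x v
      unchanged v v≢a a≁v = ∑-cong same
        where
        same : ∀ u → 𝟙 (free? v u ×-dec (K ≤? value (x [ a ]≔ t) u + value (x [ a ]≔ t) v)) ≡
                     𝟙 (free? v u ×-dec (K ≤? value x u + value x v))
        same u with u Fin.≟ a
        ... | yes refl = trans
          (𝟙-no (free? v u ×-dec (K ≤? value (x [ a ]≔ t) u + value (x [ a ]≔ t) v)) (λ ((v~u , _) , _) → a≁v (symmetric-T G v~u)))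
          (sym (𝟙-no (free? v u ×-dec (K ≤? value x u + value x v)) (λ ((v~u , _) , _) → a≁v (symmetric-T G v~u))))
        ... | no u≢a = cong (λ c → 𝟙 (free? v u ×-dec (K ≤? c)))
          (cong₂ _+_ (cong toℕ (lookup∘update′ u≢a x t)) (cong toℕ (lookup∘update′ v≢a x t)))
      pointwise : ∀ v → 𝟙 (heavyDegree (x [ a ]≔ t) v <? θ v) ≤
                        𝟙 (heavyDegree x v <? θ v) + (𝟙 (v Fin.≟ a) + 𝟙 (adjacent? G a v))
      pointwise v with v Fin.≟ a | adjacent? G a v
      ... | yes _  | _       = m≤n⇒m≤o+n (𝟙 (heavyDegree x v <? θ v)) (≤-trans (𝟙≤1 (heavyDegree (x [ a ]≔ t) v <? θ v)) (m≤m+n 1 _))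
      ... | no _   | yes _   = m≤n⇒m≤o+n (𝟙 (heavyDegree x v <? θ v)) (𝟙≤1 (heavyDegree (x [ a ]≔ t) v <? θ v))
      ... | no v≢a | no a≁v  = ≤-trans (≤-reflexive (cong (λ c → 𝟙 (c <? θ v)) (unchanged v v≢a a≁v))) (m≤m+n _ 0)

    scaled : (Fin n → ℕ) → Vec (Fin K) n → ℕ
    scaled θ x = suc d * d * #heavy< θ x

    scaled-Lipschitz : ∀ θ → Lipschitz (suc d * d * suc d) (scaled θ)
    scaled-Lipschitz θ x a t = ≤-trans (*-monoʳ-≤ (suc d * d) (#heavy<-Lipschitz θ x a t))
      (≤-reflexive (*-distribˡ-+ (suc d * d) (#heavy< θ x) (suc d)))

    private
      ev : (Fin n → ℕ) → Fin n → ℕ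
      ev θ v = suc (# (free? v)) * 𝔼 (λ x → 𝟙 (heavyDegree x v <? θ v))

      v-not-free : ∀ v → ¬ Free v v
      v-not-free v (v~v , _) = irreflexive-T G v~v

    𝔼-scaled : ∀ θ → 𝔼 (scaled θ) ≡ sum (λ v → (d + b v) * ev θ v)
    𝔼-scaled θ = begin
      𝔼 (scaled θ)
        ≡⟨ 𝔼-* (suc d * d) (#heavy< θ) ⟩
      suc d * d * 𝔼 (#heavy< θ)
        ≡⟨ cong (suc d * d *_) (𝔼-∑ (λ v x → 𝟙 (heavyDegree x v <? θ v))) ⟩
      suc d * d * sum (λ v → 𝔼 (λ x → 𝟙 (heavyDegree x v <? θ v)))
        ≡⟨ *-distribˡ-sum (suc d * d) (λ v → 𝔼 (λ x → 𝟙 (heavyDegree x v <? θ v))) ⟩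
      sum (λ v → suc d * d * 𝔼 (λ x → 𝟙 (heavyDegree x v <? θ v)))
        ≡⟨ ∑-cong (λ v → trans (cong (_* 𝔼 (λ x → 𝟙 (heavyDegree x v <? θ v))) (sym (share v))) (*-assoc (d + b v) (suc (# (free? v))) _)) ⟩
      sum (λ v → (d + b v) * ev θ v) ∎
      where open ≡-Reasoning

    𝔼-scaled-lower : ∀ θ → (∀ v → θ v ≤ suc (# (free? v))) → K ^ n * target θ ≤ 𝔼 (scaled θ)
    𝔼-scaled-lower θ θ≤ = begin
      K ^ n * target θ                               ≡⟨ *-distribˡ-sum (K ^ n) (λ v → (d + b v) * θ v) ⟩
      sum (λ v → K ^ n * ((d + b v) * θ v))          ≡⟨ ∑-cong (λ v → x∙yz≈y∙xz (K ^ n) (d + b v) (θ v)) ⟩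
      sum (λ v → (d + b v) * (K ^ n * θ v))          ≤⟨ ∑-mono (λ v → *-monoʳ-≤ (d + b v) (𝔼-#heavy<-lower (free? v) v (v-not-free v) (θ≤ v))) ⟩
      sum (λ v → (d + b v) * ev θ v)                 ≡⟨ 𝔼-scaled θ ⟨
      𝔼 (scaled θ)                                   ∎
      where open ≤-Reasoning

    -- After scaling, the ties at one vertex cost at most (d + 1) d (d + 1) / K. The assumption on K
    -- keeps the total over n vertices at most 1, the bias that `second-moment` tolerates.
    𝔼-scaled-upper : .{{_ : NonZero K}} → n * (suc d * d * suc d) ≤ K → ∀ θ → 𝔼 (scaled θ) ≤ K ^ n * target θ + K ^ n
    𝔼-scaled-upper n≤K θ = *-cancelˡ-≤ K (begin
      K * 𝔼 (scaled θ)
        ≡⟨ cong (K *_) (𝔼-scaled θ) ⟩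
      K * sum (λ v → (d + b v) * ev θ v)
        ≡⟨ *-distribˡ-sum K (λ v → (d + b v) * ev θ v) ⟩
      sum (λ v → K * ((d + b v) * ev θ v))
        ≡⟨ ∑-cong (λ v → x∙yz≈y∙xz K (d + b v) (ev θ v)) ⟩
      sum (λ v → (d + b v) * (K * ev θ v))
        ≤⟨ ∑-mono (λ v → *-monoʳ-≤ (d + b v) (𝔼-#heavy<-upper (free? v) v (v-not-free v) (θ v))) ⟩
      sum (λ v → (d + b v) * (K * (K ^ n * θ v) + K ^ n * (suc (# (free? v)) * suc (# (free? v)))))
        ≤⟨ ∑-mono simplify ⟩
      sum (λ v → K * K ^ n * ((d + b v) * θ v) + K ^ n * (suc d * d * suc d))
        ≡⟨ ∑-distrib-+ (λ v → K * K ^ n * ((d + b v) * θ v)) (λ _ → K ^ n * (suc d * d * suc d)) ⟩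
      sum (λ v → K * K ^ n * ((d + b v) * θ v)) + sum {n} (λ _ → K ^ n * (suc d * d * suc d))
        ≡⟨ cong₂ _+_ (sym (*-distribˡ-sum (K * K ^ n) (λ v → (d + b v) * θ v))) (∑-const n (K ^ n * (suc d * d * suc d))) ⟩
      K * K ^ n * target θ + n * (K ^ n * (suc d * d * suc d))
        ≡⟨ cong (K * K ^ n * target θ +_) (x∙yz≈y∙xz n (K ^ n) (suc d * d * suc d)) ⟩
      K * K ^ n * target θ + K ^ n * (n * (suc d * d * suc d))
        ≤⟨ +-monoʳ-≤ (K * K ^ n * target θ) (*-monoʳ-≤ (K ^ n) n≤K) ⟩
      K * K ^ n * target θ + K ^ n * K
        ≡⟨ regroup K (K ^ n) (target θ) ⟩
      K * (K ^ n * target θ + K ^ n) ∎)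
      where
      open ≤-Reasoning
      regroup : ∀ K N t → K * N * t + N * K ≡ K * (N * t + N)
      regroup = solve-∀
      expand : ∀ w K N t D → w * (K * (N * t) + N * (D * D)) ≡ K * N * (w * t) + N * (w * D * D)
      expand = solve-∀
      simplify : ∀ v → (d + b v) * (K * (K ^ n * θ v) + K ^ n * (suc (# (free? v)) * suc (# (free? v)))) ≤
                       K * K ^ n * ((d + b v) * θ v) + K ^ n * (suc d * d * suc d)
      simplify v = begin
        (d + b v) * (K * (K ^ n * θ v) + K ^ n * (suc (# (free? v)) * suc (# (free? v))))
          ≡⟨ expand (d + b v) K (K ^ n) (θ v) (suc (# (free? v))) ⟩
        K * K ^ n * ((d + b v) * θ v) + K ^ n * ((d + b v) * suc (# (free? v)) * suc (# (free? v)))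
          ≡⟨ cong (λ e → K * K ^ n * ((d + b v) * θ v) + K ^ n * (e * suc (# (free? v)))) (share v) ⟩
        K * K ^ n * ((d + b v) * θ v) + K ^ n * (suc d * d * suc (# (free? v)))
          ≤⟨ +-monoʳ-≤ (K * K ^ n * ((d + b v) * θ v)) (*-monoʳ-≤ (K ^ n) (*-monoʳ-≤ (suc d * d) (s≤s (#free≤d v)))) ⟩
        K * K ^ n * ((d + b v) * θ v) + K ^ n * (suc d * d * suc d) ∎

  -- heavyDegree x v < θ v holds for evenθ i iff 2 * heavyDegree x v + b v < 2 * i, and for oddθ i iff
  -- 2 * heavyDegree x v + b v < 2 * i + 1.
  evenθ oddθ : ℕ → Fin n → ℕ
  evenθ i v = i
  oddθ i v = suc i ∸ b v

  private
    evens odds : Vector (Fin n → ℕ) (suc d)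
    evens i = evenθ (toℕ i)
    odds i = oddθ (toℕ i)
    -- Both threshold families go into one vector so that a single sample is good for all 2 (d + 1)
    -- counts.
    Θ : Vector (Fin n → ℕ) (suc d + suc d)
    Θ = evens Vector.++ odds
    Θ≤ : ∀ i v → Θ i v ≤ suc (# (free? v))
    Θ≤ = All.++⁺ (λ (θ : Fin n → ℕ) → ∀ v → θ v ≤ suc (# (free? v))) {xs = evens} {ys = odds} evens≤ odds≤
      where
      open ≤-Reasoning
      evens≤ : ∀ (i : Fin (suc d)) v → toℕ i ≤ suc (# (free? v))
      evens≤ i v = begin
        toℕ i               ≤⟨ Fin.toℕ≤pred[n] i ⟩
        d                   ≤⟨ ∸-monoʳ-≤ (suc d) (𝟙≤1 (matched? v)) ⟩
        suc d ∸ b v         ≡⟨ suc-#free v ⟨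
        suc (# (free? v))   ∎
      odds≤ : ∀ (i : Fin (suc d)) v → suc (toℕ i) ∸ b v ≤ suc (# (free? v))
      odds≤ i v = begin
        suc (toℕ i) ∸ b v   ≤⟨ ∸-monoˡ-≤ (b v) (Fin.toℕ<n i) ⟩
        suc d ∸ b v         ≡⟨ suc-#free v ⟨
        suc (# (free? v))   ∎

  good-sample : ∀ {K T} → n * (suc d * d * suc d) ≤ suc K →
    (suc d + suc d) * suc (n * (suc d * d * suc d * (suc d * d * suc d))) ≤ T * T →
    ∃ λ (x : Vec (Fin (suc K)) n) → ∀ i → i ≤ d →
      ∣ scaled (evenθ i) x - target (evenθ i) ∣ ≤ T × ∣ scaled (oddθ i) x - target (oddθ i) ∣ ≤ T
  good-sample {K} {T} n≤K bound = x , λ i i≤d →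
    subst Close (trans (lookup-++ˡ evens odds (fromℕ< (s≤s i≤d))) (cong evenθ (Fin.toℕ-fromℕ< (s≤s i≤d))))
      (close (fromℕ< (s≤s i≤d) ↑ˡ suc d)) ,
    subst Close (trans (lookup-++ʳ evens odds (fromℕ< (s≤s i≤d))) (cong oddθ (Fin.toℕ-fromℕ< (s≤s i≤d))))
      (close (suc d ↑ʳ fromℕ< (s≤s i≤d)))
    where
    sample : ∃ λ (x : Vec (Fin (suc K)) n) → ∀ i → ∣ scaled (Θ i) x - target (Θ i) ∣ ≤ T
    sample = concentration (λ i → scaled (Θ i)) (λ i → scaled-Lipschitz (Θ i)) (λ i → target (Θ i))
               (λ i → 𝔼-scaled-lower (Θ i) (Θ≤ i)) (λ i → 𝔼-scaled-upper n≤K (Θ i)) T bound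
    x : Vec (Fin (suc K)) n
    x = proj₁ sample
    close : ∀ i → ∣ scaled (Θ i) x - target (Θ i) ∣ ≤ T
    close = proj₂ sample
    Close : (Fin n → ℕ) → Set
    Close θ = ∣ scaled θ x - target θ ∣ ≤ T

-- The labeling

-- p is the number of matched vertices and m bounds the deviation of the sampled counts F,
-- scaled by suc d * d, from their expectations.
module Slack {n d s h m p : ℕ} (1≤d : 1 ≤ d)
  (n≤ : n ≤ suc d * s + 1) (≤n : suc d * s ≤ n + d) (2h≤s : 2 * h ≤ s) (s≤2h : s ≤ 2 * h + 1)
  (gain : d * d + m ≤ p) (few : 4 * p ≤ n) where

  open ≤-Reasoning

  private
    instance
      D≢0 : NonZero (suc d * d)
      D≢0 = >-nonZero (≤-trans 1≤d (m≤m+n d (d * d)))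
      2D≢0 : NonZero (2 * (suc d * d))
      2D≢0 = m*n≢0 2 (suc d * d)

  d*gain : ∀ c → c ≤ d → c * (d * d + m) ≤ d * p
  d*gain c c≤d = *-mono-≤ c≤d gain

  p≤dp : p ≤ d * p
  p≤dp = m≤n*m p d {{>-nonZero 1≤d}}

  -- For i = 0 nothing is needed. For i ≥ 1 the surplus p i pays for the rounding of s (at most i
  -- d²) and for the deviation m.
  even-lower : ∀ i {F} → (d * n + p) * i ≤ suc d * d * F + m → s * i ≤ F
  even-lower zero    _  = ≤-trans (≤-reflexive (*-zeroʳ s)) z≤n
  even-lower i@(suc _) {F} le = *-cancelˡ-≤ (suc d * d) (+-cancelʳ-≤ m _ _ (begin
    suc d * d * (s * i) + m          ≡⟨ cong (_+ m) (e₁ d s i) ⟩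
    i * d * (suc d * s) + m          ≤⟨ +-mono-≤ (*-monoʳ-≤ (i * d) ≤n) (m≤n*m m i) ⟩
    i * d * (n + d) + i * m          ≡⟨ e₂ i d n m ⟩
    i * (d * n) + i * (d * d + m)    ≤⟨ +-monoʳ-≤ (i * (d * n)) (*-monoʳ-≤ i gain) ⟩
    i * (d * n) + i * p              ≡⟨ e₃ i d n p ⟩
    (d * n + p) * i                  ≤⟨ le ⟩
    suc d * d * F + m                ∎))
    where
    e₁ : ∀ d s i → suc d * d * (s * i) ≡ i * d * (suc d * s)
    e₁ = solve-∀
    e₂ : ∀ i d n m → i * d * (n + d) + i * m ≡ i * (d * n) + i * (d * d + m)
    e₂ = solve-∀
    e₃ : ∀ i d n p → i * (d * n) + i * p ≡ (d * n + p) * i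
    e₃ = solve-∀

  -- The half window h supplies the slack, about d n / 2 after scaling; `few` says that the surplus
  -- of the matched vertices, the deviation and the rounding fit into it. Doubling avoids the
  -- fraction in h.
  even-upper : ∀ j {F} → j < d → suc d * d * F ≤ (d * n + p) * suc j + m → F ≤ s * j + h + suc s
  even-upper j {F} j<d le = *-cancelˡ-≤ (2 * (suc d * d)) (+-cancelʳ-≤ C _ _ (begin
    2 * (suc d * d) * F + C
      ≡⟨ cong (_+ C) (*-assoc 2 (suc d * d) F) ⟩
    2 * (suc d * d * F) + C
      ≤⟨ +-monoˡ-≤ C (*-monoʳ-≤ 2 le) ⟩
    2 * ((d * n + p) * suc j + m) + C
      ≡⟨ e₁ d n p j m ⟩
    2 * (d * suc j) * n + (2 * (suc j * p) + 2 * (d * suc j + m)) + d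
      ≤⟨ +-monoˡ-≤ d (+-monoʳ-≤ (2 * (d * suc j) * n) (+-mono-≤ (*-monoʳ-≤ 2 (*-monoˡ-≤ p j<d)) (*-monoʳ-≤ 2 (+-monoˡ-≤ m (*-monoʳ-≤ d j<d))))) ⟩
    2 * (d * suc j) * n + (2 * (d * p) + 2 * (d * d + m)) + d
      ≤⟨ +-monoˡ-≤ d (+-monoʳ-≤ (2 * (d * suc j) * n) (+-monoʳ-≤ (2 * (d * p)) (*-monoʳ-≤ 2 (≤-trans gain p≤dp)))) ⟩
    2 * (d * suc j) * n + (2 * (d * p) + 2 * (d * p)) + d
      ≡⟨ e₂ d j n p ⟩
    2 * (d * suc j) * n + d * (4 * p) + d
      ≤⟨ +-monoˡ-≤ d (+-mono-≤ (*-monoʳ-≤ (2 * (d * suc j)) n≤) (*-monoʳ-≤ d (≤-trans few n≤))) ⟩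
    2 * (d * suc j) * (suc d * s + 1) + d * (suc d * s + 1) + d
      ≡⟨ e₃ d j s ⟩
    suc d * d * (2 * suc j * s + s) + 2 * (d * suc j) + 2 * d
      ≤⟨ +-monoˡ-≤ (2 * d) (+-monoˡ-≤ (2 * (d * suc j)) (*-monoʳ-≤ (suc d * d) (+-monoʳ-≤ (2 * suc j * s) s≤2h))) ⟩
    suc d * d * (2 * suc j * s + (2 * h + 1)) + 2 * (d * suc j) + 2 * d
      -- Padding by `d * d` completes the constants to `C` plus the `2 * (suc d * d)` contributed by
      -- the 1 in `suc s`.
      ≤⟨ m≤m+n _ (d * d) ⟩
    suc d * d * (2 * suc j * s + (2 * h + 1)) + 2 * (d * suc j) + 2 * d + d * d
      ≡⟨ e₄ d j s h ⟩
    2 * (suc d * d) * (s * j + h + suc s) + C ∎))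
    where
    C = 2 * (d * suc j) + d
    e₁ : ∀ d n p j m → 2 * ((d * n + p) * (1 + j) + m) + (2 * (d * (1 + j)) + d) ≡
                       2 * (d * (1 + j)) * n + (2 * ((1 + j) * p) + 2 * (d * (1 + j) + m)) + d
    e₁ = solve-∀
    e₂ : ∀ d j n p → 2 * (d * (1 + j)) * n + (2 * (d * p) + 2 * (d * p)) + d ≡ 2 * (d * (1 + j)) * n + d * (4 * p) + d
    e₂ = solve-∀
    e₃ : ∀ d j s → 2 * (d * (1 + j)) * ((1 + d) * s + 1) + d * ((1 + d) * s + 1) + d ≡
                   (1 + d) * d * (2 * (1 + j) * s + s) + 2 * (d * (1 + j)) + 2 * d
    e₃ = solve-∀
    e₄ : ∀ d j s h → (1 + d) * d * (2 * (1 + j) * s + (2 * h + 1)) + 2 * (d * (1 + j)) + 2 * d + d * d ≡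
                     2 * ((1 + d) * d) * (s * j + h + (1 + s)) + (2 * (d * (1 + j)) + d)
    e₄ = solve-∀

  -- Only h is demanded beyond `s * i`, while the mean is near `s * suc i`. The missing half window,
  -- d n / 2 after scaling, covers the deficit `p * (d ∸ i)`, the deviation and the rounding.
  odd-lower : ∀ i {t F} → i < d → t + p * (d ∸ i) ≡ d * suc i * n → t ≤ suc d * d * F + m → s * i + h ≤ F
  odd-lower i {t} {F} i<d t≡ le = *-cancelˡ-≤ (2 * (suc d * d)) (+-cancelʳ-≤ C _ _ (begin
    2 * (suc d * d) * (s * i + h) + C
      ≡⟨ cong (_+ C) (e₁ d s i h) ⟩
    suc d * d * (2 * i * s + 2 * h) + C
      ≤⟨ +-monoˡ-≤ C (*-monoʳ-≤ (suc d * d) (+-monoʳ-≤ (2 * i * s) 2h≤s)) ⟩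
    suc d * d * (2 * i * s + s) + C
      ≡⟨ cong (_+ C) (e₂ d s i) ⟩
    d * (2 * i + 1) * (suc d * s) + C
      ≤⟨ +-mono-≤ (*-monoʳ-≤ (d * (2 * i + 1)) ≤n) (+-monoʳ-≤ (2 * m) (*-monoʳ-≤ 2 (*-monoʳ-≤ p (m∸n≤m d i)))) ⟩
    d * (2 * i + 1) * (n + d) + (2 * m + 2 * (p * d))
      ≡⟨ e₃ d i n m p ⟩
    d * (2 * i + 1) * n + ((2 * i + 1) * (d * d) + 2 * m) + 2 * (d * p)
      ≤⟨ +-monoˡ-≤ (2 * (d * p)) (+-monoʳ-≤ (d * (2 * i + 1) * n) (+-mono-≤ (*-monoˡ-≤ (d * d) 2i+1≤2d) (*-monoʳ-≤ 2 (m≤n*m m d {{>-nonZero 1≤d}})))) ⟩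
    d * (2 * i + 1) * n + (2 * d * (d * d) + 2 * (d * m)) + 2 * (d * p)
      ≡⟨ e₄ d i n m p ⟩
    d * (2 * i + 1) * n + 2 * (d * (d * d + m)) + 2 * (d * p)
      ≤⟨ +-monoˡ-≤ (2 * (d * p)) (+-monoʳ-≤ (d * (2 * i + 1) * n) (*-monoʳ-≤ 2 (d*gain d ≤-refl))) ⟩
    d * (2 * i + 1) * n + 2 * (d * p) + 2 * (d * p)
      ≡⟨ e₅ d i n p ⟩
    d * (2 * i + 1) * n + d * (4 * p)
      ≤⟨ +-monoʳ-≤ (d * (2 * i + 1) * n) (*-monoʳ-≤ d few) ⟩
    d * (2 * i + 1) * n + d * n
      ≡⟨ e₆ d i n ⟩
    2 * (d * suc i * n)
      ≡⟨ cong (2 *_) t≡ ⟨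
    2 * (t + p * (d ∸ i))
      ≤⟨ *-monoʳ-≤ 2 (+-monoˡ-≤ (p * (d ∸ i)) le) ⟩
    2 * (suc d * d * F + m + p * (d ∸ i))
      ≡⟨ e₇ (suc d * d) F m (p * (d ∸ i)) ⟩
    2 * (suc d * d) * F + C ∎))
    where
    C = 2 * m + 2 * (p * (d ∸ i))
    2i+1≤2d : 2 * i + 1 ≤ 2 * d
    2i+1≤2d = begin
      2 * i + 1      ≤⟨ +-monoʳ-≤ (2 * i) (s≤s z≤n) ⟩
      2 * i + 2      ≡⟨ +-comm (2 * i) 2 ⟩
      2 + 2 * i      ≡⟨ *-suc 2 i ⟨
      2 * suc i      ≤⟨ *-monoʳ-≤ 2 i<d ⟩
      2 * d          ∎
    e₁ : ∀ d s i h → 2 * ((1 + d) * d) * (s * i + h) ≡ (1 + d) * d * (2 * i * s + 2 * h)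
    e₁ = solve-∀
    e₂ : ∀ d s i → (1 + d) * d * (2 * i * s + s) ≡ d * (2 * i + 1) * ((1 + d) * s)
    e₂ = solve-∀
    e₃ : ∀ d i n m p → d * (2 * i + 1) * (n + d) + (2 * m + 2 * (p * d)) ≡
                       d * (2 * i + 1) * n + ((2 * i + 1) * (d * d) + 2 * m) + 2 * (d * p)
    e₃ = solve-∀
    e₄ : ∀ d i n m p → d * (2 * i + 1) * n + (2 * d * (d * d) + 2 * (d * m)) + 2 * (d * p) ≡
                       d * (2 * i + 1) * n + 2 * (d * (d * d + m)) + 2 * (d * p)
    e₄ = solve-∀
    e₅ : ∀ d i n p → d * (2 * i + 1) * n + 2 * (d * p) + 2 * (d * p) ≡ d * (2 * i + 1) * n + d * (4 * p)
    e₅ = solve-∀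
    e₆ : ∀ d i n → d * (2 * i + 1) * n + d * n ≡ 2 * (d * (1 + i) * n)
    e₆ = solve-∀
    e₇ : ∀ D F m q → 2 * (D * F + m + q) ≡ 2 * D * F + (2 * m + 2 * q)
    e₇ = solve-∀

  -- Here the deficit `p * (d ∸ i)` is the gain: it is at least p because i < d, and p pays for m
  -- and for the rounding term d (i + 1) ≤ d².
  odd-upper : ∀ i {t F} → i < d → t + p * (d ∸ i) ≡ d * suc i * n → suc d * d * F ≤ t + m → F ≤ s * i + suc s
  odd-upper i {t} {F} i<d t≡ le = *-cancelˡ-≤ (suc d * d) (+-cancelʳ-≤ (p * (d ∸ i)) _ _ (begin
    suc d * d * F + p * (d ∸ i)                    ≤⟨ +-monoˡ-≤ (p * (d ∸ i)) le ⟩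
    t + m + p * (d ∸ i)                            ≡⟨ +ₚ.xy∙z≈xz∙y t m (p * (d ∸ i)) ⟩
    t + p * (d ∸ i) + m                            ≡⟨ cong (_+ m) t≡ ⟩
    d * suc i * n + m                              ≤⟨ +-monoˡ-≤ m (*-monoʳ-≤ (d * suc i) n≤) ⟩
    d * suc i * (suc d * s + 1) + m                ≡⟨ e₁ d i s m ⟩
    suc d * d * (s * suc i) + (d * suc i + m)      ≤⟨ +-monoʳ-≤ (suc d * d * (s * suc i)) (≤-trans (+-monoˡ-≤ m (*-monoʳ-≤ d i<d)) gain) ⟩
    suc d * d * (s * suc i) + p                    ≤⟨ +-mono-≤ (*-monoʳ-≤ (suc d * d) s*suc-i≤) (m≤m*n p (d ∸ i) {{>-nonZero (m<n⇒0<n∸m i<d)}}) ⟩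
    suc d * d * (s * i + suc s) + p * (d ∸ i)      ∎))
    where
    e₁ : ∀ d i s m → d * (1 + i) * ((1 + d) * s + 1) + m ≡ (1 + d) * d * (s * (1 + i)) + (d * (1 + i) + m)
    e₁ = solve-∀
    s*suc-i≤ : s * suc i ≤ s * i + suc s
    s*suc-i≤ = ≤-trans (≤-reflexive (trans (*-suc s i) (+-comm s (s * i)))) (+-monoʳ-≤ (s * i) (n≤1+n s))

module _ {G : Graph n} {d s m K : ℕ} (1≤d : 1 ≤ d) (regular : Regular d G) (M : Matching G m)
  (n≤ : n ≤ suc d * s + 1) (≤n : suc d * s ≤ n + d)
  (gain : d * d + m ≤ 2 * m) (few : 4 * (2 * m) ≤ n) where

  open Matching M
  open Sampling regular M

  module _ (x : Vec (Fin K) n)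
    (even-close : ∀ i → i ≤ d → ∣ scaled (evenθ i) x - target (evenθ i) ∣ ≤ m)
    (odd-close  : ∀ i → i ≤ d → ∣ scaled (oddθ i) x - target (oddθ i) ∣ ≤ m) where

    private
      h : ℕ
      h = s / 2

      s≡ : s ≡ s % 2 + 2 * h
      s≡ = trans (m≡m%n+[m/n]*n s 2) (cong (s % 2 +_) (*-comm h 2))

      2h≤s : 2 * h ≤ s
      2h≤s = ≤-trans (m≤n+m (2 * h) (s % 2)) (≤-reflexive (sym s≡))

      s≤2h+1 : s ≤ 2 * h + 1
      s≤2h+1 = ≤-trans (≤-reflexive (trans s≡ (+-comm (s % 2) (2 * h)))) (+-monoʳ-≤ (2 * h) (s≤s⁻¹ (m%n<n s 2)))

      h≤s : h ≤ s
      h≤s = ≤-trans (m≤n*m h 2) 2h≤s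

      open Slack {h = h} {p = 2 * m} 1≤d n≤ ≤n 2h≤s s≤2h+1 gain few

      g : Fin n → ℕ
      g = heavyDegree x

      heavy? : ∀ v u → Dec (K ≤ value x u + value x v)
      heavy? v u = K ≤? value x u + value x v

      f : Fin n → Fin n → ℕ
      f v u = 𝟙 (mate v Fin.≟ u) * h + 𝟙 (¬? (mate v Fin.≟ u) ×-dec heavy? v u) * s

      mate-sym : ∀ {u v} → mate u ≡ v → mate v ≡ u
      mate-sym {u} refl = involutive u

      heavy-sym : ∀ u v → K ≤ value x u + value x v → K ≤ value x v + value x u
      heavy-sym u v = subst (K ≤_) (+-comm (value x u) (value x v))

      f-sym : ∀ u v → f u v ≡ f v u
      f-sym u v = cong₂ (λ p q → p * h + q * s)
        (𝟙-cong (mate u Fin.≟ v) (mate v Fin.≟ u) mate-sym mate-sym)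
        (𝟙-cong (¬? (mate u Fin.≟ v) ×-dec heavy? u v) (¬? (mate v Fin.≟ u) ×-dec heavy? v u)
          (λ (≢ , hv) → ≢ ∘ mate-sym , heavy-sym v u hv) (λ (≢ , hv) → ≢ ∘ mate-sym , heavy-sym u v hv))

      f≤s : ∀ u v → f u v ≤ s
      f≤s u v with mate u Fin.≟ v
      ... | yes _ = ≤-trans (≤-reflexive (trans (+-identityʳ (h + 0)) (+-identityʳ h))) h≤s
      ... | no ≢  = ≤-trans (*-monoˡ-≤ s (𝟙≤1 (¬? (no ≢) ×-dec heavy? u v))) (≤-reflexive (+-identityʳ s))

      edgeSum≡ : ∀ v → edgeSum G f v ≡ s * g v + h * b v
      edgeSum≡ v = begin
        edgeSum G f v
          ≡⟨ ∑-cong (λ u → split (adjacent? G v u) (mate v Fin.≟ u) (heavy? v u)) ⟩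
        sum (λ u → s * 𝟙 (free? v u ×-dec heavy? v u) + h * (𝟙 (mate v Fin.≟ u) * 𝟙 (adjacent? G v u)))
          ≡⟨ ∑-distrib-+ (λ u → s * 𝟙 (free? v u ×-dec heavy? v u)) (λ u → h * (𝟙 (mate v Fin.≟ u) * 𝟙 (adjacent? G v u))) ⟩
        sum (λ u → s * 𝟙 (free? v u ×-dec heavy? v u)) + sum (λ u → h * (𝟙 (mate v Fin.≟ u) * 𝟙 (adjacent? G v u)))
          ≡⟨ cong₂ _+_ (*-distribˡ-sum s (λ u → 𝟙 (free? v u ×-dec heavy? v u))) (*-distribˡ-sum h (λ u → 𝟙 (mate v Fin.≟ u) * 𝟙 (adjacent? G v u))) ⟨
        s * g v + h * sum (λ u → 𝟙 (mate v Fin.≟ u) * 𝟙 (adjacent? G v u))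
          ≡⟨ cong (λ e → s * g v + h * e) (∑-mate v (λ u → 𝟙 (adjacent? G v u))) ⟩
        s * g v + h * b v ∎
        where
        open ≡-Reasoning
        split : ∀ {A B C : Set} (A? : Dec A) (B? : Dec B) (C? : Dec C) →
                𝟙 A? * (𝟙 B? * h + 𝟙 (¬? B? ×-dec C?) * s) ≡ s * 𝟙 ((A? ×-dec ¬? B?) ×-dec C?) + h * (𝟙 B? * 𝟙 A?)
        split (yes _) (yes _) (yes _) = expand₁ h s
          where expand₁ : ∀ h s → 1 * (1 * h + 0 * s) ≡ s * 0 + h * (1 * 1)
                expand₁ = solve-∀
        split (yes _) (yes _) (no _) = expand₁ h s
          where expand₁ : ∀ h s → 1 * (1 * h + 0 * s) ≡ s * 0 + h * (1 * 1)
                expand₁ = solve-∀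
        split (yes _) (no _) (yes _) = expand₂ h s
          where expand₂ : ∀ h s → 1 * (0 * h + 1 * s) ≡ s * 1 + h * (0 * 1)
                expand₂ = solve-∀
        split (yes _) (no _) (no _) = expand₃ h s
          where expand₃ : ∀ h s → 1 * (0 * h + 0 * s) ≡ s * 0 + h * (0 * 1)
                expand₃ = solve-∀
        split (no _) B? _ = expand₄ h s (𝟙 B?)
          where expand₄ : ∀ h s c → 0 ≡ s * 0 + h * (c * 0)
                expand₄ = solve-∀

      target-even : ∀ i → target (evenθ i) ≡ (d * n + 2 * m) * i
      target-even i = begin
        sum (λ v → (d + b v) * i)               ≡⟨ *-distribʳ-sum i (λ v → d + b v) ⟨
        sum (λ v → d + b v) * i                 ≡⟨ cong (_* i) (∑-distrib-+ (λ _ → d) b) ⟩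
        (sum {n} (λ _ → d) + sum b) * i         ≡⟨ cong (_* i) (cong₂ _+_ (trans (∑-const n d) (*-comm n d)) size) ⟩
        (d * n + 2 * m) * i                     ∎
        where open ≡-Reasoning

      -- Compared with an unmatched vertex, which contributes d (i + 1), a matched one contributes
      -- (d + 1) i, a loss of d - i. The loss is added on the left to avoid subtraction.
      target-odd : ∀ {i} → i < d → target (oddθ i) + 2 * m * (d ∸ i) ≡ d * suc i * n
      target-odd {i} i<d = begin
        target (oddθ i) + 2 * m * (d ∸ i)                             ≡⟨ cong (λ e → target (oddθ i) + e * (d ∸ i)) size ⟨
        target (oddθ i) + sum b * (d ∸ i)                             ≡⟨ cong (target (oddθ i) +_) (*-distribʳ-sum (d ∸ i) b) ⟩
        target (oddθ i) + sum (λ v → b v * (d ∸ i))                   ≡⟨ ∑-distrib-+ (λ v → (d + b v) * oddθ i v) (λ v → b v * (d ∸ i)) ⟨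
        sum (λ v → (d + b v) * oddθ i v + b v * (d ∸ i))              ≡⟨ ∑-cong (λ v → pointwise (matched? v)) ⟩
        sum {n} (λ _ → d * suc i)                                     ≡⟨ trans (∑-const n (d * suc i)) (*-comm n (d * suc i)) ⟩
        d * suc i * n                                                 ∎
        where
        open ≡-Reasoning
        pointwise : ∀ {P : Set} (P? : Dec P) → (d + 𝟙 P?) * (suc i ∸ 𝟙 P?) + 𝟙 P? * (d ∸ i) ≡ d * suc i
        pointwise (yes _) = begin
          (d + 1) * i + 1 * (d ∸ i)     ≡⟨ expand d i (d ∸ i) ⟩
          d * i + (i + (d ∸ i))         ≡⟨ cong (d * i +_) (m+[n∸m]≡n (<⇒≤ i<d)) ⟩
          d * i + d                     ≡⟨ trans (+-comm (d * i) d) (sym (*-suc d i)) ⟩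
          d * suc i                     ∎
          where
          expand : ∀ d i e → (d + 1) * i + 1 * e ≡ d * i + (i + e)
          expand = solve-∀
        pointwise (no _) = trans (+-identityʳ _) (cong (_* suc i) (+-identityʳ d))

      near₁ : ∀ {a t} → ∣ a - t ∣ ≤ m → t ≤ a + m
      near₁ {a} {t} ≤m = ≤-trans (m≤n+∣n-m∣ t a) (+-monoʳ-≤ a ≤m)

      near₂ : ∀ {a t} → ∣ a - t ∣ ≤ m → a ≤ t + m
      near₂ {a} {t} ≤m = ≤-trans (m≤n+∣m-n∣ a t) (+-monoʳ-≤ t ≤m)

      even-≥ : ∀ {i} → i ≤ d → s * i ≤ #heavy< (evenθ i) x
      even-≥ {i} i≤d = even-lower i
        (subst (_≤ scaled (evenθ i) x + m) (target-even i) (near₁ (even-close i i≤d)))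

      even-≤ : ∀ {j} → j < d → #heavy< (evenθ (suc j)) x ≤ s * j + h + suc s
      even-≤ {j} j<d = even-upper j j<d
        (subst (λ t → scaled (evenθ (suc j)) x ≤ t + m) (target-even (suc j)) (near₂ (even-close (suc j) j<d)))

      odd-≥ : ∀ {i} → i < d → s * i + h ≤ #heavy< (oddθ i) x
      odd-≥ {i} i<d = odd-lower i i<d (target-odd i<d) (near₁ (odd-close i (<⇒≤ i<d)))

      odd-≤ : ∀ {i} → i < d → #heavy< (oddθ i) x ≤ s * i + suc s
      odd-≤ {i} i<d = odd-upper i i<d (target-odd i<d) (near₂ (odd-close i (<⇒≤ i<d)))

      -- As h is about s / 2, the edge sum s g + h b is about h (2 g + b): sorting by κ is sorting
      -- by edge sum.
      κ : Fin n → ℕ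
      κ v = 2 * g v + b v

      b≤1 : ∀ v → b v ≤ 1
      b≤1 v = 𝟙≤1 (matched? v)

      g<⇒κ< : ∀ {u i} → g u < i → κ u < 2 * i
      g<⇒κ< {u} {i} g<i = begin-strict
        2 * g u + b u      <⟨ +-monoʳ-< (2 * g u) (s≤s (b≤1 u)) ⟩
        2 * g u + 2        ≡⟨ trans (+-comm (2 * g u) 2) (sym (*-suc 2 (g u))) ⟩
        2 * suc (g u)      ≤⟨ *-monoʳ-≤ 2 g<i ⟩
        2 * i              ∎
        where open ≤-Reasoning

      κ<⇒g< : ∀ {u i} → κ u < 2 * i → g u < i
      κ<⇒g< {u} {i} κ< = *-cancelˡ-< 2 (g u) i (≤-<-trans (m≤m+n (2 * g u) (b u)) κ<)

      oddθ⇒κ : ∀ {u i} → g u < oddθ i u → κ u < suc (2 * i)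
      oddθ⇒κ {u} {i} g< = s≤s (by-b (matched? u) g<)
        where
        open ≤-Reasoning
        by-b : ∀ {P : Set} (P? : Dec P) → g u < suc i ∸ 𝟙 P? → 2 * g u + 𝟙 P? ≤ 2 * i
        by-b (yes _) g<i = begin
          2 * g u + 1      ≤⟨ +-monoʳ-≤ (2 * g u) (s≤s z≤n) ⟩
          2 * g u + 2      ≡⟨ trans (+-comm (2 * g u) 2) (sym (*-suc 2 (g u))) ⟩
          2 * suc (g u)    ≤⟨ *-monoʳ-≤ 2 g<i ⟩
          2 * i            ∎
        by-b (no _) g≤i = ≤-trans (≤-reflexive (+-identityʳ (2 * g u))) (*-monoʳ-≤ 2 (s≤s⁻¹ g≤i))

      κ⇒oddθ : ∀ {u i} → κ u < suc (2 * i) → g u < oddθ i u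
      κ⇒oddθ {u} {i} κ≤ = by-b (matched? u) (s≤s⁻¹ κ≤)
        where
        by-b : ∀ {P : Set} (P? : Dec P) → 2 * g u + 𝟙 P? ≤ 2 * i → g u < suc i ∸ 𝟙 P?
        by-b (yes _) le = *-cancelˡ-< 2 (g u) i (≤-trans (≤-reflexive (+-comm 1 (2 * g u))) le)
        by-b (no _)  le = s≤s (*-cancelˡ-≤ 2 (≤-trans (≤-reflexive (sym (+-identityʳ (2 * g u)))) le))

      g≤#free : ∀ v → g v ≤ # (free? v)
      g≤#free v = #-mono (λ u → free? v u ×-dec heavy? v u) (free? v) (λ _ → proj₁)

      #κ< : ℕ → ℕ
      #κ< c = # (λ u → κ u <? c)

      #κ<≤n : ∀ c → #κ< c ≤ n
      #κ<≤n c = ≤-trans (∑-mono (λ u → 𝟙≤1 (κ u <? c))) (≤-reflexive (trans (∑-const n 1) (*-identityʳ n)))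

      lower : ∀ v → s * g v + h * b v ≤ #κ< (κ v)
      lower v = by-b (matched? v) (#free+b v)
        where
        open ≤-Reasoning
        by-b : ∀ {P : Set} (P? : Dec P) → # (free? v) + 𝟙 P? ≡ d → s * g v + h * 𝟙 P? ≤ #κ< (2 * g v + 𝟙 P?)
        by-b (yes _) eq = begin
          s * g v + h * 1                  ≡⟨ cong (s * g v +_) (*-identityʳ h) ⟩
          -- A matched vertex has only d - 1 free edges, which gives the strict bound g < d required
          -- here.
          s * g v + h                      ≤⟨ odd-≥ (≤-trans (s≤s (g≤#free v)) (≤-reflexive (trans (+-comm 1 (# (free? v))) eq))) ⟩
          #heavy< (oddθ (g v)) x           ≤⟨ #-mono (λ u → g u <? oddθ (g v) u) (λ u → κ u <? suc (2 * g v)) (λ _ → oddθ⇒κ) ⟩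
          #κ< (suc (2 * g v))              ≡⟨ cong #κ< (+-comm 1 (2 * g v)) ⟩
          #κ< (2 * g v + 1)                ∎
        by-b (no _) eq = begin
          s * g v + h * 0                  ≡⟨ trans (cong (s * g v +_) (*-zeroʳ h)) (+-identityʳ (s * g v)) ⟩
          s * g v                          ≤⟨ even-≥ (≤-trans (g≤#free v) (≤-reflexive (trans (sym (+-identityʳ (# (free? v)))) eq))) ⟩
          #heavy< (evenθ (g v)) x          ≤⟨ #-mono (λ u → g u <? g v) (λ u → κ u <? 2 * g v) (λ _ → g<⇒κ<) ⟩
          #κ< (2 * g v)                    ≡⟨ cong #κ< (+-identityʳ (2 * g v)) ⟨
          #κ< (2 * g v + 0)                ∎

      upper : ∀ v → #κ< (suc (κ v)) ≤ s * g v + h * b v + suc s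
      upper v = by-b (matched? v) (#free+b v)
        where
        open ≤-Reasoning
        by-b : ∀ {P : Set} (P? : Dec P) → # (free? v) + 𝟙 P? ≡ d → #κ< (suc (2 * g v + 𝟙 P?)) ≤ s * g v + h * 𝟙 P? + suc s
        by-b (yes _) eq = begin
          #κ< (suc (2 * g v + 1))          ≡⟨ cong #κ< (trans (sym (cong suc (+-comm 1 (2 * g v)))) (sym (*-suc 2 (g v)))) ⟩
          #κ< (2 * suc (g v))              ≤⟨ #-mono (λ u → κ u <? 2 * suc (g v)) (λ u → g u <? suc (g v)) (λ _ → κ<⇒g<) ⟩
          #heavy< (evenθ (suc (g v))) x    ≤⟨ even-≤ (≤-trans (s≤s (g≤#free v)) (≤-reflexive (trans (+-comm 1 (# (free? v))) eq))) ⟩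
          s * g v + h + suc s              ≡⟨ cong (λ e → s * g v + e + suc s) (*-identityʳ h) ⟨
          s * g v + h * 1 + suc s          ∎
        by-b (no _) eq with m≤n⇒m<n∨m≡n (≤-trans (g≤#free v) (≤-reflexive (trans (sym (+-identityʳ (# (free? v)))) eq)))
        ... | inj₁ g<d = begin
          #κ< (suc (2 * g v + 0))          ≡⟨ cong (#κ< ∘ suc) (+-identityʳ (2 * g v)) ⟩
          #κ< (suc (2 * g v))              ≤⟨ #-mono (λ u → κ u <? suc (2 * g v)) (λ u → g u <? oddθ (g v) u) (λ _ → κ⇒oddθ) ⟩
          #heavy< (oddθ (g v)) x           ≤⟨ odd-≤ g<d ⟩
          s * g v + suc s                  ≡⟨ cong (_+ suc s) (trans (cong (s * g v +_) (*-zeroʳ h)) (+-identityʳ (s * g v))) ⟨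
          s * g v + h * 0 + suc s          ∎
        -- The top class: its window reaches (d + 1) s + 1, so the trivial bound n on the count
        -- suffices.
        ... | inj₂ g≡d = begin
          #κ< (suc (2 * g v + 0))          ≤⟨ #κ<≤n (suc (2 * g v + 0)) ⟩
          n                                ≤⟨ n≤ ⟩
          suc d * s + 1                    ≡⟨ expand d s h ⟩
          s * d + h * 0 + suc s            ≡⟨ cong (λ e → s * e + h * 0 + suc s) g≡d ⟨
          s * g v + h * 0 + suc s          ∎
          where
          expand : ∀ d s h → (1 + d) * s + 1 ≡ s * d + h * 0 + (1 + s)
          expand = solve-∀

    labeling-from-sample : HasIrregularLabeling G (suc s)
    labeling-from-sample = labeling-from-classes G regular f f-sym f≤s κ
      (λ v → ≤-trans (≤-reflexive (edgeSum≡ v)) (lower v))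
      (λ v → ≤-trans (upper v) (≤-reflexive (cong (_+ suc s) (sym (edgeSum≡ v)))))

-- Choice of the parameters and conclusion

irregular-labeling : {G : Graph n} {d s m : ℕ} → 1 ≤ d → Regular d G →
  n ≤ suc d * s + 1 → suc d * s ≤ n + d →
  2 * m * suc d ≤ n → d * d + m ≤ 2 * m → 4 * (2 * m) ≤ n →
  (suc d + suc d) * suc (n * (suc d * d * suc d * (suc d * d * suc d))) ≤ m * m →
  HasIrregularLabeling G (suc s)
irregular-labeling {n} {d = d} {m = m} 1≤d regular n≤ ≤n room gain few bound =
  -- The range of the random values is 1 + n (d + 1) d (d + 1): large enough for the ties and never
  -- zero. The tolerated deviation T is m itself.
  labeling (Sampling.good-sample regular M (n≤1+n (n * (suc d * d * suc d))) bound)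
  where
  M = large-matching 1≤d regular m room
  labeling : _ → _
  labeling (x , close) = labeling-from-sample 1≤d regular M n≤ ≤n gain few x
    (λ i i≤d → proj₁ (close i i≤d)) (λ i i≤d → proj₂ (close i i≤d))

module _ (d : ℕ) where

  private
    -- `c` is the Lipschitz constant of the scaled counts and `r` the number of counts. `m₁` comes
    -- from n ≤ 16 (d + 1) m, which gives r (1 + n c²) ≤ m `m₁`; so m ≥ `m₁` makes the deviation at
    -- most m.
    c r m₁ : ℕ
    c = suc d * d * suc d
    r = suc d + suc d
    m₁ = r * (16 * suc d * suc (c * c))

  threshold : ℕ
  threshold = m₁ * (8 * suc d)

  large-irregular-labeling : ∀ {s} {G : Graph n} → 1 ≤ d → n ≥ threshold → Regular d G →
    n ≤ suc d * s + 1 → suc d * s ≤ n + d → HasIrregularLabeling G (suc s)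
  large-irregular-labeling {n} 1≤d n≥ regular n≤ ≤n = irregular-labeling {m = m} 1≤d regular n≤ ≤n
    (begin
      2 * m * suc d        ≡⟨ e₁ m d ⟩
      m * (2 * suc d)      ≤⟨ *-monoʳ-≤ m (*-monoˡ-≤ (suc d) (s≤s (s≤s (z≤n {6})))) ⟩
      m * (8 * suc d)      ≤⟨ m/n*n≤m n (8 * suc d) ⟩
      n                    ∎)
    (begin
      d * d + m            ≤⟨ +-monoˡ-≤ m (≤-trans d²≤m₁ m₁≤m) ⟩
      m + m                ≡⟨ cong (m +_) (+-identityʳ m) ⟨
      2 * m                ∎)
    (begin
      4 * (2 * m)          ≡⟨ e₂ m ⟩
      m * (8 * 1)          ≤⟨ *-monoʳ-≤ m (*-monoʳ-≤ 8 (s≤s (z≤n {d}))) ⟩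
      m * (8 * suc d)      ≤⟨ m/n*n≤m n (8 * suc d) ⟩
      n                    ∎)
    (begin
      r * suc (n * (c * c))                           ≤⟨ *-monoʳ-≤ r (+-mono-≤ 1≤16m (*-monoˡ-≤ (c * c) n≤16m)) ⟩
      r * (m * (16 * suc d) + m * (16 * suc d) * (c * c))   ≡⟨ e₃ r m (16 * suc d) (c * c) ⟩
      m * m₁                                          ≤⟨ *-monoʳ-≤ m m₁≤m ⟩
      m * m                                           ∎)
    where
    open ≤-Reasoning
    m : ℕ
    m = n / (8 * suc d)
    e₁ : ∀ m d → 2 * m * (1 + d) ≡ m * (2 * (1 + d))
    e₁ = solve-∀
    e₂ : ∀ m → 4 * (2 * m) ≡ m * (8 * 1)
    e₂ = solve-∀
    e₃ : ∀ r m e q → r * (m * e + m * e * q) ≡ m * (r * (e * (1 + q)))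
    e₃ = solve-∀
    e₄ : ∀ m d → (m + m) * (8 * (1 + d)) ≡ m * (16 * (1 + d))
    e₄ = solve-∀
    m₁≤m : m₁ ≤ m
    m₁≤m = ≤-trans (≤-reflexive (sym (m*n/n≡m m₁ (8 * suc d)))) (/-monoˡ-≤ (8 * suc d) n≥)
    d≤c : d ≤ c
    d≤c = ≤-trans (m≤n*m d (suc d)) (m≤m*n (suc d * d) (suc d))
    d²≤m₁ : d * d ≤ m₁
    d²≤m₁ = begin
      d * d                           ≤⟨ *-mono-≤ d≤c d≤c ⟩
      c * c                           ≤⟨ n≤1+n (c * c) ⟩
      suc (c * c)                     ≤⟨ m≤n*m (suc (c * c)) (16 * suc d) ⟩
      16 * suc d * suc (c * c)        ≤⟨ m≤n*m (16 * suc d * suc (c * c)) r ⟩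
      m₁                              ∎
    1≤m : 1 ≤ m
    1≤m = ≤-trans (*-mono-≤ 1≤d 1≤d) (≤-trans d²≤m₁ m₁≤m)
    1≤16m : 1 ≤ m * (16 * suc d)
    1≤16m = *-mono-≤ 1≤m (s≤s z≤n)
    n≤16m : n ≤ m * (16 * suc d)
    -- Rounding down in m = n / (8 (d + 1)) loses at most a factor 2 since m ≥ 1.
    n≤16m = begin
      n                                         ≡⟨ m≡m%n+[m/n]*n n (8 * suc d) ⟩
      n % (8 * suc d) + m * (8 * suc d)         ≤⟨ +-monoˡ-≤ (m * (8 * suc d)) (<⇒≤ (m%n<n n (8 * suc d))) ⟩
      suc m * (8 * suc d)                       ≤⟨ *-monoˡ-≤ (8 * suc d) (+-monoˡ-≤ m 1≤m) ⟩
      (m + m) * (8 * suc d)                     ≡⟨ e₄ m d ⟩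
      m * (16 * suc d)                          ∎

-- The first inequality says that the (d + 1) s + 1 shifted weights suffice for n vertices; the
-- second limits the excess from rounding up.
ceiling-bounds : ∀ n d → 1 ≤ n → ∃ λ s → ⌈ (n + d) / suc d ⌉ ≡ suc s × n ≤ suc d * s + 1 × suc d * s ≤ n + d
ceiling-bounds n d 1≤n with ⌈ (n + d) / suc d ⌉ in eq
... | zero  = contradiction eq m≢0
  where
  m≢0 : (n + d + d) / suc d ≢ 0
  m≢0 eq₀ = <⇒≱ (m/n≡0⇒m<n eq₀) (+-monoˡ-≤ d (≤-trans 1≤n (m≤m+n n d)))
... | suc s = s , refl , upper , lower
  where
  open ≤-Reasoning
  division : n + d + d ≡ (n + d + d) % suc d + suc s * suc d
  division = trans (m≡m%n+[m/n]*n (n + d + d) (suc d)) (cong (λ q → (n + d + d) % suc d + q * suc d) eq)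
  e₁ : ∀ d s → d + (1 + s) * (1 + d) ≡ (1 + d) * s + 1 + d + d
  e₁ = solve-∀
  e₂ : ∀ d s → (1 + d) * s + d + 1 ≡ (1 + s) * (1 + d)
  e₂ = solve-∀
  upper : n ≤ suc d * s + 1
  upper = +-cancelʳ-≤ d _ _ (+-cancelʳ-≤ d _ _ (begin
    n + d + d                                  ≡⟨ division ⟩
    (n + d + d) % suc d + suc s * suc d        ≤⟨ +-monoˡ-≤ (suc s * suc d) (s≤s⁻¹ (m%n<n (n + d + d) (suc d))) ⟩
    d + suc s * suc d                          ≡⟨ e₁ d s ⟩
    suc d * s + 1 + d + d                      ∎))
  lower : suc d * s ≤ n + d
  lower = +-cancelʳ-≤ d _ _ (begin
    suc d * s + d                              ≤⟨ m≤m+n (suc d * s + d) 1 ⟩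
    suc d * s + d + 1                          ≡⟨ e₂ d s ⟩
    suc s * suc d                              ≤⟨ m≤n+m (suc s * suc d) ((n + d + d) % suc d) ⟩
    (n + d + d) % suc d + suc s * suc d        ≡⟨ division ⟨
    n + d + d                                  ∎)

theorem4p2 : ∀ (d : ℕ) → d ≥ 2 → Σ[ n₁ ∈ ℕ ] (∀ (n : ℕ) → n ≥ n₁ → (G : Graph n) → Regular d G → IsTvs G ⌈ (n + d) / suc d ⌉)
theorem4p2 d d≥2 = suc (threshold d) , tvs
  where
  tvs : ∀ n → n ≥ suc (threshold d) → (G : Graph n) → Regular d G → IsTvs G ⌈ (n + d) / suc d ⌉
  tvs n n≥ G regular with s , k≡ , n≤ , ≤n ← ceiling-bounds n d (≤-trans (s≤s z≤n) n≥) =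
    subst (1 ≤_) (sym k≡) (s≤s z≤n) ,
    subst (HasIrregularLabeling G) (sym k≡)
      (large-irregular-labeling d (<⇒≤ d≥2) (<⇒≤ n≥) regular n≤ ≤n) ,
    λ j 1≤j labeling → s≤s⁻¹ (m<n*o⇒m/o<n {n = suc j} (begin-strict
      n + d + d             ≤⟨ +-monoˡ-≤ d (labeling-bound G regular 1≤j labeling) ⟩
      suc d * j + d         <⟨ n<1+n (suc d * j + d) ⟩
      suc (suc d * j + d)   ≡⟨ e d j ⟩
      suc j * suc d         ∎))
    where
    open ≤-Reasoning
    e : ∀ d j → 1 + ((1 + d) * j + d) ≡ (1 + j) * (1 + d)
    e = solve-∀
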